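{- Let $r>1$ be an irrational number and $P_r=\{\lfloor nr\rfloor : n\in\mathbb{Z}\setminus\{0\}\}$. For each integer $m\geq 1$ let $D_{m,+}^{\mathbb{Z}}=\{x\in\mathbb{Z}: x=my \text{ for some } y\in P_r\}$ and $D_{m,- }^{\mathbb{Z}}=\{x\in\mathbb{Z}: x=my\text{ for some }y\in\mathbb{Z}\setminus P_r\}$. Then the structure $\big(\mathbb{Z},+,-,0,1,(D_{m,+}^{\mathbb{Z}})_{m\geq1},(D_{m,- }^{\mathbb{Z}})_{m\geq1}\big)$, in the language $L_\pm=\{+,-,0,1\}\cup\{D_{m,+},D_{m,- }: m\geq 1\}$ (with $D_{m,\pm}$ unary predicate symbols), has quantifier elimination.
   Context: Note $D_{1,+}^{\mathbb{Z}}=P_r$ and $D_{m,+}^{\mathbb{Z}}\cup D_{m,- }^{\mathbb{Z}}=m\mathbb{Z}$. -}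

module Defs where

open import Data.Bool using (Bool; true; false)
open import Data.Nat as ℕ using (ℕ; suc)
open import Data.Integer as ℤ using (ℤ; +_; -[1+_]; 0ℤ; 1ℤ)
open import Data.Rational as ℚ using (ℚ; _/_)
open import Data.Fin using (Fin)
open import Data.Product using (Σ; _×_; ∃)
open import Data.Empty using (⊥)
open import Data.Unit using (⊤)
open import Relation.Binary.PropositionalEquality using (_≡_; _≢_)
open import Relation.Nullary using (¬_)

-- Irrational real numbers, as Dedekind cuts of ℚ.
-- Classically, an irrational real r is the same thing as a partition of
-- ℚ into a lower set L = {q | q < r} and an upper set U = {q | r < q},
-- both nonempty, L downward closed, L without maximum, U without minimum
-- (no rational equals r).  We encode L by its characteristic function.

record IrrationalReal : Set where
  field
    below  : ℚ → Bool                      -- below q ≡ true  iff  q < r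
    down   : ∀ p q → p ℚ.≤ q → below q ≡ true → below p ≡ true
    inhL   : ∃ λ q → below q ≡ true
    inhU   : ∃ λ q → below q ≡ false
    noMax  : ∀ q → below q ≡ true  → ∃ λ q' → q ℚ.< q' × below q' ≡ true
    noMin  : ∀ q → below q ≡ false → ∃ λ q' → q' ℚ.< q × below q' ≡ false

open IrrationalReal public

_>1 : IrrationalReal → Set
r >1 = below r ℚ.1ℚ ≡ true

-- "z ≤ n · r" for integers z, n.
--   n = k+1 > 0 :  z ≤ n r  ⇔  z/n ≤ r  ⇔  z/n < r   (r irrational)
--   n = -(k+1)  :  z ≤ n r  ⇔  r ≤ (-z)/(k+1)  ⇔  ¬ ((-z)/(k+1) < r)
--   n = 0       :  z ≤ 0
LeMul : IrrationalReal → ℤ → ℤ → Set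
LeMul r z (+ 0)      = z ℤ.≤ 0ℤ
LeMul r z (+ suc k)  = below r (z / suc k) ≡ true
LeMul r z -[1+ k ]   = below r ((ℤ.- z) / suc k) ≡ false

IsFloorMul : IrrationalReal → ℤ → ℤ → Set
IsFloorMul r n y = LeMul r y n × ¬ LeMul r (y ℤ.+ 1ℤ) n

P : IrrationalReal → ℤ → Set
P r y = Σ ℤ λ n → n ≢ 0ℤ × IsFloorMul r n y

-- D_{m,+} and D_{m,-}  (m ≥ 1 is used through its predecessor: m = suc k)
Dplus : IrrationalReal → ℕ → ℤ → Set
Dplus r m x = Σ ℤ λ y → x ≡ (+ m) ℤ.* y × P r y

Dminus : IrrationalReal → ℕ → ℤ → Set
Dminus r m x = Σ ℤ λ y → x ≡ (+ m) ℤ.* y × ¬ P r y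

-- The language L± = {+, -, 0, 1} ∪ {D_{m,+}, D_{m,-} : m ≥ 1}.
-- Terms and formulas with free variables among Fin n (de Bruijn: the
-- quantifiers bind variable zero).  "-" is unary negation.

data Term (n : ℕ) : Set where
  var  : Fin n → Term n
  zer  : Term n
  one  : Term n
  _⊕_  : Term n → Term n → Term n
  ⊖_   : Term n → Term n

data Formula : ℕ → Set where
  tt ff  : ∀ {n} → Formula n
  _≐_    : ∀ {n} → Term n → Term n → Formula n
  D+ D-  : ∀ {n} → (k : ℕ) → Term n → Formula n   -- D_{k+1,+} t, D_{k+1,-} t
  ~_     : ∀ {n} → Formula n → Formula n
  _∧_ _∨_ : ∀ {n} → Formula n → Formula n → Formula n
  Ex All : ∀ {n} → Formula (suc n) → Formula n

data QuantifierFree : ∀ {n} → Formula n → Set where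
  tt  : ∀ {n} → QuantifierFree {n} tt
  ff  : ∀ {n} → QuantifierFree {n} ff
  eq  : ∀ {n} (s t : Term n) → QuantifierFree (s ≐ t)
  dp  : ∀ {n} k (t : Term n) → QuantifierFree (D+ k t)
  dm  : ∀ {n} k (t : Term n) → QuantifierFree (D- k t)
  neg : ∀ {n} {φ : Formula n} → QuantifierFree φ → QuantifierFree (~ φ)
  and : ∀ {n} {φ ψ : Formula n} → QuantifierFree φ → QuantifierFree ψ → QuantifierFree (φ ∧ ψ)
  or  : ∀ {n} {φ ψ : Formula n} → QuantifierFree φ → QuantifierFree ψ → QuantifierFree (φ ∨ ψ)

Env : ℕ → Set
Env n = Fin n → ℤ

extend : ∀ {n} → ℤ → Env n → Env (suc n)
extend a ρ Fin.zero    = a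
extend a ρ (Fin.suc i) = ρ i

⟦_⟧t : ∀ {n} → Term n → Env n → ℤ
⟦ var i ⟧t ρ = ρ i
⟦ zer ⟧t ρ   = 0ℤ
⟦ one ⟧t ρ   = 1ℤ
⟦ s ⊕ t ⟧t ρ = ⟦ s ⟧t ρ ℤ.+ ⟦ t ⟧t ρ
⟦ ⊖ t ⟧t ρ   = ℤ.- ⟦ t ⟧t ρ

-- Satisfaction in the structure (ℤ, +, -, 0, 1, (D_{m,+})_{m≥1}, (D_{m,-})_{m≥1}).
-- Classical (Gödel–Gentzen) reading of ∨ and ∃, so that this is the
-- usual two-valued Tarskian satisfaction relation.
Sat : IrrationalReal → ∀ {n} → Formula n → Env n → Set
Sat r tt ρ        = ⊤
Sat r ff ρ        = ⊥
Sat r (s ≐ t) ρ   = ⟦ s ⟧t ρ ≡ ⟦ t ⟧t ρ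
Sat r (D+ k t) ρ  = Dplus  r (suc k) (⟦ t ⟧t ρ)
Sat r (D- k t) ρ  = Dminus r (suc k) (⟦ t ⟧t ρ)
Sat r (~ φ) ρ     = ¬ Sat r φ ρ
Sat r (φ ∧ ψ) ρ   = Sat r φ ρ × Sat r ψ ρ
Sat r (φ ∨ ψ) ρ   = ¬ (¬ Sat r φ ρ × ¬ Sat r ψ ρ)
Sat r (Ex φ) ρ    = ¬ (∀ a → ¬ Sat r φ (extend a ρ))
Sat r (All φ) ρ   = ∀ a → Sat r φ (extend a ρ)

HasQE : IrrationalReal → Set
HasQE r = ∀ {n} (φ : Formula n) → Σ (Formula n) λ ψ →
            QuantifierFree ψ × (∀ (ρ : Env n) → (Sat r φ ρ → Sat r ψ ρ) × (Sat r ψ ρ → Sat r φ ρ))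

{-# OPTIONS --safe #-}
-- Put α = 1/r and F t = ⌊α t⌋.  An integer y lies in P_r iff y ≠ −1 and F (y + 1) = F y + 1,
-- so D_{m,+} and D_{m,−} are Boolean combinations of conditions t = 0, t ∈ S and F t ∈ S
-- with S a periodic set of integers.
--
-- Boolean combinations of these conditions admit quantifier elimination by virtual
-- substitution.  If some x satisfies φ, it either solves one of the equations a x + s = 0
-- in φ, so x = −s/a may be substituted, or all of them may be replaced by falsity.  In the
-- second case the truth of φ depends on x modulo a period and on the position of α x on a
-- circle, where φ defines a union of half-open arcs [ , ); if nonempty, it contains the
-- left endpoint of an arc, given by α (a x + s) ≡ j with a x + s a term of φ.
-- Conversely α x comes arbitrarily close to such an endpoint from the right for
-- arbitrarily large x, since α is irrational.
--
-- Finally t ∈ S and F t ∈ S are definable in the original language.  For t = b v + c the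
-- value F t modulo b is ⌊b {α v}⌋ plus the number of s < c with F (b v + s + 1) ≠ F (b v + s),
-- and the digit ⌊b {α v}⌋ is located by comparing {α v} with the numbers 1 − {α K}.
module Submission where

open import Defs
open import Data.Bool using (Bool; true; false; not) renaming (_∧_ to _∧ᵇ_; _∨_ to _∨ᵇ_)
open import Data.Bool.Properties using (∨-identityʳ) renaming (_≟_ to _≟ᵇ_)
open import Data.Empty using (⊥; ⊥-elim)
open import Data.Fin using (Fin)
open import Data.Integer as ℤ using (ℤ; +_; -[1+_]; 0ℤ; 1ℤ; _+_; _*_; -_; _-_; _≤_; _<_; _≤?_; +≤+; ∣_∣)
open import Data.Integer.DivMod using (_/ℕ_; _%ℕ_; n%ℕd<d; a≡a%ℕn+[a/ℕn]*n; [n/ℕd]*d≤n; n<s[n/ℕd]*d)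
open import Data.Integer.Properties as ℤP using (≤-refl; ≤-trans; ≤-reflexive; ≤-antisym; _≟_)
open import Data.Integer.Tactic.RingSolver using (solve-∀)
open import Data.List using (List; []; _∷_; _++_; map; upTo)
open import Data.List.Membership.Propositional using (_∈_; find; lose)
open import Data.List.Membership.Propositional.Properties using (∈-upTo⁺; ∈-map⁻)
open import Data.List.Relation.Unary.All as Each using ([]; _∷_) renaming (All to Each)
import Data.List.Relation.Unary.All.Properties as EachP
open import Data.List.Relation.Unary.Any using (Any; here; there; any?)
open import Data.Nat as ℕ using (ℕ; zero; suc; s≤s; z≤n)
import Data.Nat.Properties as ℕP
open import Data.Product using (Σ; _×_; _,_; proj₁; proj₂)
open import Data.Rational as ℚ using (_/_; toℚᵘ)
open import Data.Rational.Properties using (toℚᵘ-fromℚᵘ; fromℚᵘ-toℚᵘ; toℚᵘ-cancel-≤; toℚᵘ-mono-<)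
open import Data.Rational.Unnormalised using (mkℚᵘ; *≤*; *<*)
import Data.Rational.Unnormalised.Properties as ℚᵘP
open import Data.Sum using (_⊎_; inj₁; inj₂)
open import Data.Unit using (⊤)
open import Function using (_∘_; mk⇔)
open import Relation.Binary.PropositionalEquality using (_≡_; _≢_; refl; sym; trans; cong; cong₂; subst; subst₂)
open import Relation.Nullary using (¬_; Dec; yes; no; does; contradiction)
open import Relation.Nullary.Decidable using (dec-true; dec-false; does-⇔; map′; ¬?; _×-dec_; _⊎-dec_)

-- The obstacle is that the endpoint of an arc need not be attained: no integer x has to satisfy α
-- (a x + s) = j, so ℤ contains nothing to substitute. Floors are right-continuous, however, so
-- immediately to the right of the endpoint every floor keeps its value at the endpoint, which is
-- ⌊(a′ j + α u) / a⌋ with u free of x. The division by a can be carried out after taking `F u`, so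
-- it changes only the periodic set; this is the reason for admitting arbitrary periodic sets in the
-- atoms rather than single congruences. Large x serve to falsify all equations at once. The
-- exception y = -1 comes from 0 = α · 0, the only integer among the values α t, while n = 0 is left
-- out of P_r. On the way back, a fraction i / b is only approximated by the available thresholds;
-- whether b v is a jump repairs the error. The cut is Boolean, so the order of ℤ + ℤ α is decidable
-- and truth values of combinations of atoms are Booleans. This reconciles explicit computation with
-- the negative reading of ∨ and ∃ in `Sat`.

-- Linear inequalities over ℤ, certified by ring identities

≤-by : ∀ {i j k l} → i ≤ j → j - i ≡ l - k → k ≤ l
≤-by p e = ℤP.0≤i-j⇒j≤i (subst (0ℤ ≤_) e (ℤP.i≤j⇒0≤j-i p))

≤-by₂ : ∀ {i j i′ j′ k l} → i ≤ j → i′ ≤ j′ → (j - i) + (j′ - i′) ≡ l - k → k ≤ l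
≤-by₂ p q e = ℤP.0≤i-j⇒j≤i (subst (0ℤ ≤_) e (ℤP.+-mono-≤ (ℤP.i≤j⇒0≤j-i p) (ℤP.i≤j⇒0≤j-i q)))

≤-absurd : ∀ {i j} → i ≤ j → j - i ≡ - 1ℤ → ⊥
≤-absurd p e with subst (0ℤ ≤_) e (ℤP.i≤j⇒0≤j-i p)
... | ()

≤-absurd₂ : ∀ {i j i′ j′} → i ≤ j → i′ ≤ j′ → (j - i) + (j′ - i′) ≡ - 1ℤ → ⊥
≤-absurd₂ p q e with subst (0ℤ ≤_) e (ℤP.+-mono-≤ (ℤP.i≤j⇒0≤j-i p) (ℤP.i≤j⇒0≤j-i q))
... | ()

≰⇒1+≤ : ∀ {i j} → ¬ i ≤ j → 1ℤ + j ≤ i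
≰⇒1+≤ p = ℤP.i<j⇒suc[i]≤j (ℤP.≰⇒> p)

i≤+∣i∣ : ∀ i → i ≤ + ℤ.∣ i ∣
i≤+∣i∣ (+ n) = ≤-refl
i≤+∣i∣ -[1+ n ] = ℤ.-≤+

-- The order on ℤ + ℤ α

module Cut (r : IrrationalReal) (r>1 : r >1) where

  -- The rational `z / suc k` is normalised, so numerator and denominator cannot be inferred from
  -- it; the record keeps them visible.
  record Lo (z : ℤ) (k : ℕ) : Set where
    constructor lo
    field isBelow : below r (z / suc k) ≡ true

  Lo-mono : ∀ z k z′ k′ → z′ * + suc k ≤ z * + suc k′ → Lo z k → Lo z′ k′
  Lo-mono z k z′ k′ p (lo q) = lo (down r _ _ (toℚᵘ-cancel-≤
    (ℚᵘP.≤-respˡ-≃ (ℚᵘP.≃-sym (toℚᵘ-fromℚᵘ (mkℚᵘ z′ k′)))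
      (ℚᵘP.≤-respʳ-≃ (ℚᵘP.≃-sym (toℚᵘ-fromℚᵘ (mkℚᵘ z k))) (*≤* p)))) q)

  private
    <-cross : ∀ z k z′ k′ → (z / suc k) ℚ.< (z′ / suc k′) → z * + suc k′ < z′ * + suc k
    <-cross z k z′ k′ p
      with ℚᵘP.<-respˡ-≃ (toℚᵘ-fromℚᵘ (mkℚᵘ z k))
             (ℚᵘP.<-respʳ-≃ (toℚᵘ-fromℚᵘ (mkℚᵘ z′ k′)) (toℚᵘ-mono-< p))
    ... | *<* q = q

    as-fraction : ∀ q → Σ ℤ λ z → Σ ℕ λ k → z / suc k ≡ q
    as-fraction q with toℚᵘ q | fromℚᵘ-toℚᵘ q
    ... | mkℚᵘ z k | e = z , k , e

  Lo-noMax : ∀ z k → Lo z k → Σ ℤ λ z′ → Σ ℕ λ k′ → Lo z′ k′ × 1ℤ + z * + suc k′ ≤ z′ * + suc k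
  Lo-noMax z k (lo p) with noMax r _ p
  ... | q , lt , b with as-fraction q
  ... | z′ , k′ , refl = z′ , k′ , lo b , ℤP.i<j⇒suc[i]≤j (<-cross z k z′ k′ lt)

  Up⇒¬Lo : ∀ {z k} → below r (z / suc k) ≡ false → ¬ Lo z k
  Up⇒¬Lo p (lo q) with trans (sym p) q
  ... | ()

  ¬Lo⇒Up : ∀ {z k} → ¬ Lo z k → below r (z / suc k) ≡ false
  ¬Lo⇒Up {z} {k} p with below r (z / suc k) in eq′
  ... | true = contradiction (lo eq′) p
  ... | false = refl

  ¬Lo-noMin : ∀ z k → ¬ Lo z k →
    Σ ℤ λ z′ → Σ ℕ λ k′ → ¬ Lo z′ k′ × 1ℤ + z′ * + suc k ≤ z * + suc k′
  ¬Lo-noMin z k p with noMin r _ (¬Lo⇒Up p)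
  ... | q , lt , b with as-fraction q
  ... | z′ , k′ , refl = z′ , k′ , Up⇒¬Lo b , ℤP.i<j⇒suc[i]≤j (<-cross z′ k′ z k lt)

  -- NN a b states 0 ≤ a + b α for α = 1/r, in the equivalent form − b ≤ a r.
  record NN (a b : ℤ) : Set where
    constructor nn
    field le-mul : LeMul r (- b) a
  open NN public

  NN? : ∀ a b → Dec (NN a b)
  NN? a b = map′ nn le-mul (dec a)
    where
    dec : ∀ a → Dec (LeMul r (- b) a)
    dec (+ 0) = _ ≤? _
    dec (+ suc k) = _ ≟ᵇ _
    dec -[1+ k ] = _ ≟ᵇ _

  private
    -- The mediant of two fractions is at most the larger of them.
    Lo-add : ∀ z k z′ k′ → Lo z k → Lo z′ k′ → Lo (z + z′) (k ℕ.+ suc k′)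
    Lo-add z k z′ k′ p q with z * + suc k′ ≤? z′ * + suc k
    ... | yes le = Lo-mono z′ k′ _ _ (≤-by le (ring₁ z (+ suc k) z′ (+ suc k′))) q
      where ring₁ : ∀ z k z′ k′ → z′ * k - z * k′ ≡ z′ * (k + k′) - (z + z′) * k′
            ring₁ = solve-∀
    ... | no ¬le = Lo-mono z k _ _ (≤-by (ℤP.<⇒≤ (ℤP.≰⇒> ¬le)) (ring₂ z (+ suc k) z′ (+ suc k′))) p
      where ring₂ : ∀ z k z′ k′ → z * k′ - z′ * k ≡ z * (k + k′) - (z + z′) * k
            ring₂ = solve-∀

    -- The mediant of two fractions is at least the smaller of them.
    ¬Lo-add : ∀ z k z′ k′ → ¬ Lo z k → ¬ Lo z′ k′ → ¬ Lo (z + z′) (k ℕ.+ suc k′)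
    ¬Lo-add z k z′ k′ p q l with z * + suc k′ ≤? z′ * + suc k
    ... | yes le = p (Lo-mono _ _ z k (≤-by le (ring₁ z (+ suc k) z′ (+ suc k′))) l)
      where ring₁ : ∀ z k z′ k′ → z′ * k - z * k′ ≡ (z + z′) * k - z * (k + k′)
            ring₁ = solve-∀
    ... | no ¬le = q (Lo-mono _ _ z′ k′ (≤-by (ℤP.<⇒≤ (ℤP.≰⇒> ¬le)) (ring₂ z (+ suc k) z′ (+ suc k′))) l)
      where ring₂ : ∀ z k z′ k′ → z * k′ - z′ * k ≡ (z + z′) * k′ - z′ * (k + k′)
            ring₂ = solve-∀

    Lo-¬Lo : ∀ z k z′ k′ → Lo z k → ¬ Lo z′ k′ → 1ℤ + z * + suc k′ ≤ z′ * + suc k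
    Lo-¬Lo z k z′ k′ p q = ≰⇒1+≤ λ le → q (Lo-mono z k z′ k′ le p)

  data NNView : ℤ → ℤ → Set where
    pos  : ∀ {k b} → Lo (- b) k → NNView (+ suc k) b
    null : ∀ {b} → 0ℤ ≤ b → NNView 0ℤ b
    neg  : ∀ {k b} → ¬ Lo b k → NNView -[1+ k ] b

  view : ∀ a b → NN a b → NNView a b
  view (+ 0) b (nn p) = null (subst (0ℤ ≤_) (ℤP.neg-involutive b) (ℤP.neg-mono-≤ p))
  view (+ suc k) b (nn p) = pos (lo p)
  view -[1+ k ] b (nn p) = neg (subst (λ z → ¬ Lo z k) (ℤP.neg-involutive b) (Up⇒¬Lo p))

  unview : ∀ {a b} → NNView a b → NN a b
  unview (pos (lo p)) = nn p
  unview (null p) = nn (ℤP.neg-mono-≤ p)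
  unview {b = b} (neg {k} p) = nn (¬Lo⇒Up (subst (λ z → ¬ Lo z k) (sym (ℤP.neg-involutive b)) p))

  private
    -- The hypotheses give -b / (k+1) < r ≤ d / (k′+1), and the sign of the difference `e` of the
    -- denominators decides which claim is due. For `e` < 0 the fraction d / (k′+1) is the mediant
    -- of (b+d) / (m+1) and -b / (k+1), so it would lie below r if the former did.
    add-pos-neg : ∀ {k b k′ d} e → Lo (- b) k → ¬ Lo d k′ → e ≡ + suc k - + suc k′ → NNView e (b + d)
    add-pos-neg {k} {b} {k′} {d} (+ suc m) p q e = pos (Lo-mono (- b) k (- (b + d)) m
      (≤-by (ℤP.<⇒≤ (ℤP.suc[i]≤j⇒i<j (Lo-¬Lo (- b) k d k′ p q)))
        (trans (ring₁ (+ suc k) b (+ suc k′) d)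
          (cong (λ m → - b * m - - (b + d) * + suc k) (sym e)))) p)
      where ring₁ : ∀ k b k′ d → d * k - - b * k′ ≡ - b * (k - k′) - - (b + d) * k
            ring₁ = solve-∀
    add-pos-neg {k} {b} {k′} {d} (+ 0) p q e = null (ℤP.*-cancelʳ-≤-pos 0ℤ (b + d) (+ suc k)
      (≤-by (ℤP.<⇒≤ (ℤP.suc[i]≤j⇒i<j (Lo-¬Lo (- b) k d k′ p q)))
        (trans (cong (λ l → d * + suc k - - b * l) (sym (ℤP.i-j≡0⇒i≡j _ _ (sym e)))) (ring₁ (+ suc k) b d))))
      where ring₁ : ∀ k b d → d * k - - b * k ≡ (b + d) * k - 0ℤ * k
            ring₁ = solve-∀
    add-pos-neg {k} {b} {k′} {d} -[1+ m ] p q e = neg λ l → q (Lo-mono _ _ d k′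
      (≤-reflexive (trans (cong (d *_) (trans (ring₁ (+ suc k) (+ suc m))
        (trans (cong (λ x → + suc k - x) e) (ring₂ (+ suc k) (+ suc k′))))) (ring₃ b d (+ suc k′))))
      (Lo-add (b + d) m (- b) k l p))
      where ring₁ : ∀ k m → m + k ≡ k - - m
            ring₁ = solve-∀
            ring₂ : ∀ k k′ → k - (k - k′) ≡ k′
            ring₂ = solve-∀
            ring₃ : ∀ b d k → d * k ≡ ((b + d) + - b) * k
            ring₃ = solve-∀

    ≤-+ : ∀ b d → 0ℤ ≤ d → b ≤ d + b
    ≤-+ b d q = subst (_≤ d + b) (ℤP.+-identityˡ b) (ℤP.+-monoˡ-≤ b q)

    null-add : ∀ {a b d} → 0ℤ ≤ d → NNView a b → NNView a (d + b)
    null-add {b = b} {d} q (pos {k} p) = pos (Lo-mono _ k _ k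
      (ℤP.*-monoʳ-≤-nonNeg (+ suc k) (ℤP.neg-mono-≤ (≤-+ b d q))) p)
    null-add q (null p) = null (ℤP.+-mono-≤ q p)
    null-add {b = b} {d} q (neg {k} p) = neg λ l → p (Lo-mono _ k _ k
      (ℤP.*-monoʳ-≤-nonNeg (+ suc k) (≤-+ b d q)) l)

    add : ∀ {a b c d} → NNView a b → NNView c d → NNView (a + c) (b + d)
    add {b = b} {d = d} (pos {k} p) (pos {k′} q) =
      pos (subst (λ z → Lo z _) (sym (ℤP.neg-distrib-+ b d)) (Lo-add (- b) k (- d) k′ p q))
    add (pos p) (neg q) = add-pos-neg _ p q refl
    add {b = b} {d = d} (neg {k} p) (pos {k′} q) =
      subst (NNView _) (ℤP.+-comm d b) (add-pos-neg _ q p (ℤP.+-comm -[1+ k ] (+ suc k′)))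
    add {b = b} {d = d} (neg {k} p) (neg {k′} q) =
      neg (subst (λ n → ¬ Lo (b + d) n) (ℕP.+-suc k k′) (¬Lo-add b k d k′ p q))
    add {c = c} (null p) q = subst (λ a → NNView a _) (sym (ℤP.+-identityˡ c)) (null-add p q)
    add {a} {b} {d = d} p (null q) = subst₂ NNView (sym (ℤP.+-identityʳ a)) (ℤP.+-comm d b) (null-add q p)

  nn-add : ∀ {a b c d} → NN a b → NN c d → NN (a + c) (b + d)
  nn-add {a} {b} {c} {d} p q = unview (add (view a b p) (view c d q))

  ¬NN⇒NN- : ∀ {a b} → ¬ NN a b → NN (- a) (- b)
  ¬NN⇒NN- {+ 0} {b} p = nn (ℤP.neg-mono-≤ (ℤP.<⇒≤ (ℤP.≰⇒> λ le → p (nn le))))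
  ¬NN⇒NN- {+ suc k} {b} p = unview (neg λ (lo l) → p (nn l))
  ¬NN⇒NN- { -[1+ k ]} {b} p with below r ((- - b) / suc k) in l
  ... | true = nn l
  ... | false = contradiction (nn l) p

  -- This is the independence of 1 and α over ℤ. For a ≠ 0 the two hypotheses demand opposite values
  -- of one bit of the cut, since no rational equals r.
  nn-antisym : ∀ {a b} → NN a b → NN (- a) (- b) → a ≡ 0ℤ × b ≡ 0ℤ
  nn-antisym {+ 0} {b} (nn p) (nn q) = refl , ≤-antisym (subst₂ _≤_ (ℤP.neg-involutive b) refl q)
                                      (subst (0ℤ ≤_) (ℤP.neg-involutive b) (ℤP.neg-mono-≤ p))
  nn-antisym {+ suc k} {b} (nn p) (nn q) =
    ⊥-elim (Up⇒¬Lo q (subst (λ z → Lo z k) (sym (ℤP.neg-involutive (- b))) (lo p)))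
  nn-antisym { -[1+ k ]} {b} (nn p) (nn q) = ⊥-elim (Up⇒¬Lo { - - b} {k} p (lo q))

  nn-α : NN 0ℤ 1ℤ
  nn-α = nn ℤ.-≤+

  nn-1-α : NN 1ℤ (- 1ℤ)
  nn-1-α = nn r>1

  nn-*α : ∀ {b} → 0ℤ ≤ b → NN 0ℤ b
  nn-*α p = nn (ℤP.neg-mono-≤ p)

  nn-scale : ∀ n {a b} → NN a b → NN (+ n * a) (+ n * b)
  nn-scale zero p = nn ≤-refl
  nn-scale (suc n) {a} {b} p = subst₂ NN (sym (ℤP.suc-* (+ n) a)) (sym (ℤP.suc-* (+ n) b))
    (nn-add p (nn-scale n p))

  -- An upper bound z / (k+1) of r gives α z ≥ k + 1; then k is subtracted and z is replaced by its
  -- absolute value.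
  α-arch : Σ ℕ λ n → NN (- 1ℤ) (+ n)
  α-arch with inhU r
  ... | q , up with as-fraction q
  ... | z , k , refl = ℤ.∣ z ∣ , subst₂ NN (ring₁ (+ k)) (ring₂ (+ k) z (+ ℤ.∣ z ∣))
      (nn-add (nn-add (unview { -[1+ k ]} {z} (neg (Up⇒¬Lo up))) (nn-scale k (nn-add nn-1-α nn-α)))
              (nn-*α (ℤP.i≤j⇒0≤j-i (i≤+∣i∣ z))))
    where
    ring₁ : ∀ k → - (1ℤ + k) + k * (1ℤ + 0ℤ) + 0ℤ ≡ - 1ℤ
    ring₁ = solve-∀
    ring₂ : ∀ k z w → z + k * (- 1ℤ + 1ℤ) + (w - z) ≡ w
    ring₂ = solve-∀

  -- Some multiple of a positive element reaches α. As neither half of the cut has an extremal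
  -- element, there is a fraction z / (k′+1) strictly between -b / a and r when a ≠ 0. Its
  -- denominator is the multiplier, and the strict inequality between integers leaves a whole α.
  nn-arch : ∀ {a b} → ¬ NN (- a) (- b) → Σ ℕ λ d → NN (+ suc d * a) (+ suc d * b - 1ℤ)
  nn-arch {a} {b} ¬p = go _ _ (view a b (subst₂ NN (ℤP.neg-involutive a) (ℤP.neg-involutive b) (¬NN⇒NN- ¬p))) ¬p
    where
    go : ∀ a b → NNView a b → ¬ NN (- a) (- b) → Σ ℕ λ d → NN (+ suc d * a) (+ suc d * b - 1ℤ)
    go _ b (pos {k} p) _ with Lo-noMax _ k p
    ... | z , k′ , l , le = k′ , subst₂ NN (ring₁ (+ suc k) (+ suc k′)) (ring₂ z (+ suc k) b (+ suc k′))
          (nn-add (nn-scale (suc k) (unview (pos {k′} { - z} (subst (λ z → Lo z k′) (sym (ℤP.neg-involutive z)) l))))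
                  (nn-*α (ℤP.i≤j⇒0≤j-i le)))
      where
      ring₁ : ∀ k k′ → k * k′ + 0ℤ ≡ k′ * k
      ring₁ = solve-∀
      ring₂ : ∀ z k b k′ → k * - z + (z * k - (1ℤ + - b * k′)) ≡ k′ * b - 1ℤ
      ring₂ = solve-∀
    go _ b (null p) ¬q = 0 , nn-*α (subst (0ℤ ≤_) (cong (_- 1ℤ) (sym (ℤP.*-identityˡ b)))
        (ℤP.i≤j⇒0≤j-i (ℤP.i<j⇒suc[i]≤j (ℤP.≰⇒> λ (le : b ≤ 0ℤ) → ¬q (nn-*α (ℤP.neg-mono-≤ le))))))
    go _ b (neg {k} p) _ with ¬Lo-noMin b k p
    ... | z , k′ , ¬l , le = k′ , subst₂ NN (ring₁ (+ suc k) (+ suc k′)) (ring₂ z (+ suc k) b (+ suc k′))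
          (nn-add (nn-scale (suc k) (unview (neg {k′} {z} ¬l)))
                  (nn-*α (ℤP.i≤j⇒0≤j-i le)))
      where
      ring₁ : ∀ k k′ → k * - k′ + 0ℤ ≡ k′ * - k
      ring₁ = solve-∀
      ring₂ : ∀ z k b k′ → k * z + (b * k′ - (1ℤ + z * k)) ≡ k′ * b - 1ℤ
      ring₂ = solve-∀

-- Floors and small elements in the ordered group ℤ + ℤ α

module Group (r : IrrationalReal) (r>1 : r >1) where
  open Cut r r>1

  -- PP a b states 0 < a + b α.
  record PP (a b : ℤ) : Set where
    constructor pp
    field ¬nn- : ¬ NN (- a) (- b)

  nn-by : ∀ {a b c d} → NN a b → a ≡ c → b ≡ d → NN c d
  nn-by p refl refl = p

  pp-by : ∀ {a b c d} → PP a b → a ≡ c → b ≡ d → PP c d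
  pp-by p refl refl = p

  pp⇒nn : ∀ {a b} → PP a b → NN a b
  pp⇒nn {a} {b} (pp p) = nn-by (¬NN⇒NN- p) (ℤP.neg-involutive a) (ℤP.neg-involutive b)

  ¬nn⇒pp : ∀ {a b} → ¬ NN a b → PP (- a) (- b)
  ¬nn⇒pp {a} {b} p = pp λ q → p (nn-by q (ℤP.neg-involutive a) (ℤP.neg-involutive b))

  pp-absurd : ∀ {a b} → PP a b → a ≡ 0ℤ → b ≡ 0ℤ → ⊥
  pp-absurd (pp p) refl refl = p (nn-*α ≤-refl)

  pp-add : ∀ {a b c d} → NN a b → PP c d → PP (a + c) (b + d)
  pp-add {a} {b} {c} {d} p (pp q) = pp λ s → q (nn-by (nn-add p s) (cancel a c) (cancel b d))
    where cancel : ∀ a c → a + - (a + c) ≡ - c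
          cancel = solve-∀

  nn-scaleℤ : ∀ {z a b} → 0ℤ ≤ z → NN a b → NN (z * a) (z * b)
  nn-scaleℤ {+ n} _ p = nn-scale n p

  pp-scale : ∀ n {a b} → PP a b → PP (+ suc n * a) (+ suc n * b)
  pp-scale n {a} {b} p = pp-by (pp-add (nn-scale n (pp⇒nn p)) p) (ring₁ (+ n) a) (ring₁ (+ n) b)
    where ring₁ : ∀ n a → n * a + a ≡ (1ℤ + n) * a
          ring₁ = solve-∀

  pp-cancel : ∀ n {a b} → PP (+ n * a) (+ n * b) → PP a b
  pp-cancel n {a} {b} (pp p) = pp λ q → p (nn-by (nn-scale n q) (ring₁ (+ n) a) (ring₁ (+ n) b))
    where ring₁ : ∀ n a → n * - a ≡ - (n * a)
          ring₁ = solve-∀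

  nn-cancel : ∀ n {a b} → NN (+ suc n * a) (+ suc n * b) → NN a b
  nn-cancel n {a} {b} p with NN? a b
  ... | yes q = q
  ... | no ¬q = ⊥-elim (pp-absurd (pp-add p (pp-scale n (¬nn⇒pp ¬q)))
                  (ring₁ (+ suc n) a) (ring₁ (+ suc n) b))
    where ring₁ : ∀ n a → n * a + n * - a ≡ 0ℤ
          ring₁ = solve-∀

  nn-irr : ∀ {a b} → b ≢ 0ℤ → NN a b → PP a b
  nn-irr ne p = pp λ q → ne (proj₂ (nn-antisym p q))

  nn-1 : NN 1ℤ 0ℤ
  nn-1 = nn-add nn-1-α nn-α

  pp-1 : PP 1ℤ 0ℤ
  pp-1 = pp λ q → case (proj₁ (nn-antisym nn-1 q))
    where case : 1ℤ ≡ 0ℤ → ⊥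
          case ()

  pp-α : PP 0ℤ 1ℤ
  pp-α = nn-irr (λ ()) nn-α

  pp-1-α : PP 1ℤ (- 1ℤ)
  pp-1-α = nn-irr (λ ()) nn-1-α

  nn-int : ∀ {c} → 0ℤ ≤ c → NN c 0ℤ
  nn-int {c} p = nn-by (nn-scaleℤ p nn-1) (ℤP.*-identityʳ c) (ℤP.*-zeroʳ c)

  nn-int⁻¹ : ∀ {c} → NN c 0ℤ → 0ℤ ≤ c
  nn-int⁻¹ {c} p with 0ℤ ≤? c
  ... | yes q = q
  ... | no ¬q = ⊥-elim (pp-absurd (pp-add p (pp-add (nn-int (ℤP.i≤j⇒0≤j-i (≰⇒1+≤ ¬q))) pp-1)) (ring₁ c) refl)
    where ring₁ : ∀ c → c + (0ℤ - (1ℤ + c) + 1ℤ) ≡ 0ℤ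
          ring₁ = solve-∀

  arch-bound : ∀ {p q} a b d R → NN (+ suc d * p) (+ suc d * q - 1ℤ) → NN (- 1ℤ) (+ R) →
    Σ ℕ λ k → NN (+ k * p - a) (+ k * q - b)
  arch-bound {p} {q} a b d R ηd αR = m ℕ.* suc d , nn-by
      (nn-add (nn-scale m ηd) (nn-add (nn-add (nn-scale ∣ a ∣ αR) (nn-int (ℤP.i≤j⇒0≤j-i (i≤+∣i∣ a))))
                                      (nn-*α (ℤP.i≤j⇒0≤j-i (i≤+∣i∣ b)))))
      (trans (ring₁ (+ m) (+ suc d) p a (+ ∣ a ∣)) (cong (λ k → k * p - a) (sym (ℤP.pos-* m (suc d)))))
      (trans (cong (λ k → k * (+ suc d * q - 1ℤ) + (+ ∣ a ∣ * + R + 0ℤ + (+ ∣ b ∣ - b))) m≡)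
        (trans (ring₂ (+ ∣ a ∣) (+ R) (+ ∣ b ∣) (+ suc d) q b)
          (cong (λ k → k * q - b) (trans (cong (_* + suc d) (sym m≡)) (sym (ℤP.pos-* m (suc d)))))))
    where
    -- Each block of d + 1 copies reaches α, and `R` such blocks reach 1: so |a| R blocks cover a,
    -- and |b| further blocks cover b α.
    m = ∣ a ∣ ℕ.* R ℕ.+ ∣ b ∣
    m≡ : + m ≡ + ∣ a ∣ * + R + + ∣ b ∣
    m≡ = trans (ℤP.pos-+ (∣ a ∣ ℕ.* R) ∣ b ∣) (cong (_+ + ∣ b ∣) (ℤP.pos-* ∣ a ∣ R))
    ring₁ : ∀ m d p a w → m * (d * p) + (w * - 1ℤ + (w - a) + 0ℤ) ≡ m * d * p - a
    ring₁ = solve-∀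
    ring₂ : ∀ w R v d q b → (w * R + v) * (d * q - 1ℤ) + (w * R + 0ℤ + (v - b)) ≡ (w * R + v) * d * q - b
    ring₂ = solve-∀

  abstract
    arch : ∀ {p q} a b → PP p q → Σ ℕ λ k → NN (+ k * p - a) (+ k * q - b)
    arch a b (pp η) =
      let d , ηd = nn-arch η
          R , αR = α-arch
      in arch-bound a b d R ηd αR

  -- The integer quotient ⌊(a + b α) / (p + q α)⌋ together with its two bounds.
  Floor : (a b p q : ℤ) → Set
  Floor a b p q = Σ ℤ λ n → NN (a - n * p) (b - n * q) × PP ((1ℤ + n) * p - a) ((1ℤ + n) * q - b)

  floor-search : ∀ {p q} a b → PP p q → ∀ fuel n →
    NN (a - n * p) (b - n * q) → NN ((n + + fuel) * p - a) ((n + + fuel) * q - b) → Floor a b p q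
  floor-search {p} {q} a b η zero n l u = n , l , pp-by (pp-add u η) (ring₁ n p a) (ring₁ n q b)
    where ring₁ : ∀ n p a → (n + 0ℤ) * p - a + p ≡ (1ℤ + n) * p - a
          ring₁ = solve-∀
  floor-search {p} {q} a b η (suc fuel) n l u with NN? (a - (1ℤ + n) * p) (b - (1ℤ + n) * q)
  ... | yes l′ = floor-search a b η fuel (1ℤ + n) l′ (nn-by u (ring₁ (+ fuel) n p a) (ring₁ (+ fuel) n q b))
    where ring₁ : ∀ f n p a → (n + (1ℤ + f)) * p - a ≡ (1ℤ + n + f) * p - a
          ring₁ = solve-∀
  ... | no ¬l′ = n , l , pp-by (¬nn⇒pp ¬l′) (ring₁ n p a) (ring₁ n q b)
    where ring₁ : ∀ n p a → - (a - (1ℤ + n) * p) ≡ (1ℤ + n) * p - a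
          ring₁ = solve-∀

  abstract
    floor : ∀ {p q} a b → PP p q → Floor a b p q
    floor {p} {q} a b η =
      let k₁ , lower = arch (- a) (- b) η
          k₂ , upper = arch a b η
      in floor-search a b η (k₁ ℕ.+ k₂) (- + k₁)
        (nn-by lower (ring₁ (+ k₁) p a) (ring₁ (+ k₁) q b))
        (nn-by upper (ring₂ k₁ k₂ p a) (ring₂ k₁ k₂ q b))
      where
      ring₁ : ∀ k p a → k * p - - a ≡ a - - k * p
      ring₁ = solve-∀
      ring₃ : ∀ k l → l ≡ - k + (k + l)
      ring₃ = solve-∀
      ring₂ : ∀ k₁ k₂ p a → + k₂ * p - a ≡ (- + k₁ + + (k₁ ℕ.+ k₂)) * p - a
      ring₂ k₁ k₂ p a = cong (λ k → k * p - a)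
        (trans (ring₃ (+ k₁) (+ k₂)) (cong (λ k → - + k₁ + k) (sym (ℤP.pos-+ k₁ k₂))))

  abstract
    F : ℤ → ℤ
    F t = proj₁ (floor 0ℤ t pp-1)

    F-lower : ∀ t → NN (- F t) t
    F-lower t = nn-by (proj₁ (proj₂ (floor 0ℤ t pp-1))) (ring₁ (F t)) (ring₂ (F t) t)
      where ring₁ : ∀ n → 0ℤ - n * 1ℤ ≡ - n
            ring₁ = solve-∀
            ring₂ : ∀ n t → t - n * 0ℤ ≡ t
            ring₂ = solve-∀

    F-upper : ∀ t → PP (1ℤ + F t) (- t)
    F-upper t = pp-by (proj₂ (proj₂ (floor 0ℤ t pp-1))) (ring₁ (F t)) (ring₂ (F t) t)
      where ring₁ : ∀ n → (1ℤ + n) * 1ℤ - 0ℤ ≡ 1ℤ + n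
            ring₁ = solve-∀
            ring₂ : ∀ n t → (1ℤ + n) * 0ℤ - t ≡ - t
            ring₂ = solve-∀

  ≤F⇒nn : ∀ {n t} → n ≤ F t → NN (- n) t
  ≤F⇒nn {n} {t} p = nn-by (nn-add (nn-int (ℤP.i≤j⇒0≤j-i p)) (F-lower t)) (ring₁ n (F t)) (ℤP.+-identityˡ t)
    where ring₁ : ∀ n f → f - n + - f ≡ - n
          ring₁ = solve-∀

  F<⇒pp : ∀ {n t} → 1ℤ + F t ≤ n → PP n (- t)
  F<⇒pp {n} {t} p = pp-by (pp-add (nn-int (ℤP.i≤j⇒0≤j-i p)) (F-upper t)) (ring₁ n (F t)) (ℤP.+-identityˡ (- t))
    where ring₁ : ∀ n f → n - (1ℤ + f) + (1ℤ + f) ≡ n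
          ring₁ = solve-∀

  nn⇒≤F : ∀ {n t} → NN (- n) t → n ≤ F t
  nn⇒≤F {n} {t} p with n ≤? F t
  ... | yes q = q
  ... | no ¬q = ⊥-elim (pp-absurd (pp-add p (F<⇒pp (≰⇒1+≤ ¬q))) (ℤP.+-inverseˡ n) (ℤP.+-inverseʳ t))

  pp⇒F< : ∀ {n t} → PP n (- t) → 1ℤ + F t ≤ n
  pp⇒F< {n} {t} p with 1ℤ + F t ≤? n
  ... | yes q = q
  ... | no ¬q = ⊥-elim (pp-absurd (pp-add (≤F⇒nn n≤F) p) (ℤP.+-inverseˡ n) (ℤP.+-inverseʳ t))
    where n≤F : n ≤ F t
          n≤F = ≤-by (≰⇒1+≤ ¬q) (ring₁ n (F t))
            where ring₁ : ∀ n f → (1ℤ + f) - (1ℤ + n) ≡ f - n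
                  ring₁ = solve-∀

  F-unique : ∀ {n t} → NN (- n) t → PP (1ℤ + n) (- t) → F t ≡ n
  F-unique {n} {t} p q = ≤-antisym (≤-by (pp⇒F< q) (ring₁ n (F t))) (nn⇒≤F p)
    where ring₁ : ∀ n f → (1ℤ + n) - (1ℤ + f) ≡ n - f
          ring₁ = solve-∀

  private
    *≢0 : ∀ {i j} → i ≢ 0ℤ → j ≢ 0ℤ → i * j ≢ 0ℤ
    *≢0 {i} p q e with ℤP.i*j≡0⇒i≡0∨j≡0 i e
    ... | inj₁ e = p e
    ... | inj₂ e = q e

    1≤⇒≢0 : ∀ {i} → 1ℤ ≤ i → i ≢ 0ℤ
    1≤⇒≢0 (+≤+ ()) refl

  -- For 0 < g < 1 and n = ⌊1/g⌋ the numbers 1 − n g and (n+1) g − 1 add up to g,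
  -- so one of them is at most g/2; both are irrational.
  SmallIrrational : ℕ → Set
  SmallIrrational k = Σ ℤ λ p → Σ ℤ λ b → b ≢ 0ℤ × PP p b × NN (1ℤ - + suc k * p) (- (+ suc k * b))

  small-step : ∀ {p b} k n → b ≢ 0ℤ → PP p b → NN (1ℤ - + suc k * p) (- (+ suc k * b)) →
    NN (1ℤ - n * p) (0ℤ - n * b) → PP ((1ℤ + n) * p - 1ℤ) ((1ℤ + n) * b - 0ℤ) → SmallIrrational (suc k)
  small-step {p} {b} k n b≢0 g>0 kg≤1 u≥0 v>0 = choose (NN? (u₁ - v₁) (u₂ - v₂))
    where
    u₁ = 1ℤ - n * p
    u₂ = 0ℤ - n * b
    v₁ = (1ℤ + n) * p - 1ℤ
    v₂ = (1ℤ + n) * b - 0ℤ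
    -- If n ≤ 0 then (n+1) g ≤ g ≤ 1, against v > 0. Only n ≠ 0 keeps the α-coefficient -n b of u
    -- nonzero.
    n≥1 : 1ℤ ≤ n
    n≥1 with 1ℤ ≤? n
    ... | yes q = q
    ... | no ¬q = ⊥-elim (pp-absurd (pp-add (nn-scaleℤ -n≥0 (pp⇒nn g>0))
                    (pp-add (nn-add (nn-scale k (pp⇒nn g>0)) kg≤1) v>0))
                    (ring₁ n p (+ k)) (ring₂ n b (+ k)))
      where
      -n≥0 : 0ℤ ≤ - n
      -n≥0 = ≤-by (≰⇒1+≤ ¬q) (ring₃ n)
        where ring₃ : ∀ n → 1ℤ - (1ℤ + n) ≡ - n - 0ℤ
              ring₃ = solve-∀
      ring₁ : ∀ n p k → - n * p + (k * p + (1ℤ - (1ℤ + k) * p) + ((1ℤ + n) * p - 1ℤ)) ≡ 0ℤ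
      ring₁ = solve-∀
      ring₂ : ∀ n p k → - n * p + (k * p + - ((1ℤ + k) * p) + ((1ℤ + n) * p - 0ℤ)) ≡ 0ℤ
      ring₂ = solve-∀
    u₂≢0 : u₂ ≢ 0ℤ
    u₂≢0 e = *≢0 (1≤⇒≢0 n≥1) b≢0 (trans (ring₁ (n * b)) (cong -_ e))
      where ring₁ : ∀ x → x ≡ - (0ℤ - x)
            ring₁ = solve-∀
    v₂≢0 : v₂ ≢ 0ℤ
    v₂≢0 e = *≢0 (1≤⇒≢0 {1ℤ + n} (≤-by₂ n≥1 (+≤+ {0} {1} z≤n) (ring₂ n))) b≢0 (trans (ring₁ ((1ℤ + n) * b)) e)
      where ring₁ : ∀ x → x ≡ x - 0ℤ
            ring₁ = solve-∀
            ring₂ : ∀ n → n - 1ℤ + (1ℤ - 0ℤ) ≡ 1ℤ + n - 1ℤ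
            ring₂ = solve-∀
    -- From 2 g′ ≤ g and (k+1) g ≤ 1 follows (2k+2) g′ ≤ 1, and 2k + 2 ≥ k + 2.
    halve : ∀ {p′ b′} → b′ ≢ 0ℤ → NN p′ b′ → NN (p - + 2 * p′) (b - + 2 * b′) →
      SmallIrrational (suc k)
    halve {p′} {b′} b′≢0 g′≥0 2g′≤g = p′ , b′ , b′≢0 , nn-irr b′≢0 g′≥0 ,
      nn-by (nn-add kg≤1 (nn-add (nn-scale (suc k) 2g′≤g) (nn-scale k g′≥0)))
        (ring₁ (+ k) p p′) (ring₂ (+ k) b b′)
      where
      ring₁ : ∀ k p q → 1ℤ - (1ℤ + k) * p + ((1ℤ + k) * (p - + 2 * q) + k * q) ≡ 1ℤ - (+ 2 + k) * q
      ring₁ = solve-∀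
      ring₂ : ∀ k p q → - ((1ℤ + k) * p) + ((1ℤ + k) * (p - + 2 * q) + k * q) ≡ - ((+ 2 + k) * q)
      ring₂ = solve-∀
    choose : Dec (NN (u₁ - v₁) (u₂ - v₂)) →
      SmallIrrational (suc k)
    choose (yes v≤u) = halve v₂≢0 (pp⇒nn v>0) (nn-by v≤u (ring₁ n p) (ring₂ n b))
      where ring₁ : ∀ n p → 1ℤ - n * p - ((1ℤ + n) * p - 1ℤ) ≡ p - + 2 * ((1ℤ + n) * p - 1ℤ)
            ring₁ = solve-∀
            ring₂ : ∀ n p → 0ℤ - n * p - ((1ℤ + n) * p - 0ℤ) ≡ p - + 2 * ((1ℤ + n) * p - 0ℤ)
            ring₂ = solve-∀
    choose (no ¬v≤u) = halve u₂≢0 u≥0 (nn-by (¬NN⇒NN- ¬v≤u) (ring₁ n p) (ring₂ n b))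
      where ring₁ : ∀ n p → - (1ℤ - n * p - ((1ℤ + n) * p - 1ℤ)) ≡ p - + 2 * (1ℤ - n * p)
            ring₁ = solve-∀
            ring₂ : ∀ n p → - (0ℤ - n * p - ((1ℤ + n) * p - 0ℤ)) ≡ p - + 2 * (0ℤ - n * p)
            ring₂ = solve-∀

  abstract
    small : ∀ k → SmallIrrational k
    small zero = 0ℤ , 1ℤ , (λ ()) , pp-α , nn-1-α
    small (suc k) = let p , b , b≢0 , g>0 , kg≤1 = small k
                        n , u≥0 , v>0 = floor 1ℤ 0ℤ g>0
                    in small-step k n b≢0 g>0 kg≤1 u≥0 v>0

  SmallMultiple : (e f : ℤ) → ℕ → Set
  SmallMultiple e f n = Σ ℤ λ p → Σ ℤ λ b → b ≢ 0ℤ × PP p b × NN (e - + n * p) (f - + n * b)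

  -- With m ε ≥ 1 and (1 + m n) g ≤ 1 one has m n g ≤ m ε, and m cancels.
  small-multiple-from : ∀ {e f} n m → NN (+ m * e - 1ℤ) (+ m * f - 0ℤ) → SmallMultiple e f n
  small-multiple-from n zero bad = ⊥-elim (1≰0 (nn-int⁻¹ bad))
    where 1≰0 : ¬ 0ℤ ≤ - 1ℤ
          1≰0 ()
  small-multiple-from {e} {f} n (suc m) mε≥1 =
    let p , b , b≢0 , g>0 , small-g = small (suc m ℕ.* n)
    in p , b , b≢0 , g>0 ,
       nn-cancel m (nn-by (nn-add mε≥1 (nn-add small-g (pp⇒nn g>0))) (eq₁ p) (eq₂ b))
    where
    ring₁ : ∀ m e p n → m * e - 1ℤ + (1ℤ - (1ℤ + m * n) * p + p) ≡ m * (e - n * p)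
    ring₁ = solve-∀
    ring₂ : ∀ m e p n → m * e - 0ℤ + (- ((1ℤ + m * n) * p) + p) ≡ m * (e - n * p)
    ring₂ = solve-∀
    eq₁ : ∀ p → + suc m * e - 1ℤ + (1ℤ - + suc (suc m ℕ.* n) * p + p) ≡ + suc m * (e - + n * p)
    eq₁ p = trans (cong (λ k → + suc m * e - 1ℤ + (1ℤ - (1ℤ + k) * p + p)) (ℤP.pos-* (suc m) n))
                  (ring₁ (+ suc m) e p (+ n))
    eq₂ : ∀ b → + suc m * f - 0ℤ + (- (+ suc (suc m ℕ.* n) * b) + b) ≡ + suc m * (f - + n * b)
    eq₂ b = trans (cong (λ k → + suc m * f - 0ℤ + (- ((1ℤ + k) * b) + b)) (ℤP.pos-* (suc m) n))
                  (ring₂ (+ suc m) f b (+ n))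

  abstract
    small-multiple : ∀ {e f} → PP e f → ∀ n → SmallMultiple e f n
    small-multiple ε>0 n = let m , mε≥1 = arch 1ℤ 0ℤ ε>0 in small-multiple-from n m mε≥1

-- z ÷ k is ⌊z / (k+1)⌋.
abstract
  _÷_ : ℤ → ℕ → ℤ
  z ÷ k = z /ℕ suc k

  ÷-lower : ∀ z k → + suc k * (z ÷ k) ≤ z
  ÷-lower z k = subst (_≤ z) (ℤP.*-comm (z ÷ k) (+ suc k)) ([n/ℕd]*d≤n z (suc k))

  ÷-upper : ∀ z k → 1ℤ + z ≤ + suc k * (1ℤ + z ÷ k)
  ÷-upper z k = subst (1ℤ + z ≤_) (ℤP.*-comm (1ℤ + z ÷ k) (+ suc k))
    (ℤP.i<j⇒suc[i]≤j (n<s[n/ℕd]*d z (suc k)))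

÷-≤ : ∀ {z k q} → + suc k * q ≤ z → q ≤ z ÷ k
÷-≤ {z} {k} {q} p with q ≤? z ÷ k
... | yes r = r
... | no ¬r = ⊥-elim (≤-absurd₂ (≤-trans (÷-upper z k) (ℤP.*-monoˡ-≤-nonNeg (+ suc k) (≰⇒1+≤ ¬r))) p
                (ring₁ z (+ suc k * q)))
  where ring₁ : ∀ z m → m - (1ℤ + z) + (z - m) ≡ - 1ℤ
        ring₁ = solve-∀

÷-< : ∀ {z k q} → 1ℤ + z ≤ + suc k * (1ℤ + q) → z ÷ k ≤ q
÷-< {z} {k} {q} p with z ÷ k ≤? q
... | yes r = r
... | no ¬r = ⊥-elim (≤-absurd₂ (≤-trans (ℤP.*-monoˡ-≤-nonNeg (+ suc k) (≰⇒1+≤ ¬r)) (÷-lower z k)) p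
                (ring₁ z (+ suc k * (1ℤ + q))))
  where ring₁ : ∀ z m → z - m + (m - (1ℤ + z)) ≡ - 1ℤ
        ring₁ = solve-∀

÷-unique : ∀ {z k q} → + suc k * q ≤ z → 1ℤ + z ≤ + suc k * (1ℤ + q) → z ÷ k ≡ q
÷-unique p q = ≤-antisym (÷-< q) (÷-≤ p)

÷-+* : ∀ z k q → (z + + suc k * q) ÷ k ≡ (z ÷ k) + q
÷-+* z k q = ÷-unique (≤-by (÷-lower z k) (ring₁ (+ suc k) (z ÷ k) z q))
                      (≤-by (÷-upper z k) (ring₂ (+ suc k) (z ÷ k) z q))
  where ring₁ : ∀ k d z q → z - k * d ≡ z + k * q - k * (d + q)
        ring₁ = solve-∀
        ring₂ : ∀ k d z q → k * (1ℤ + d) - (1ℤ + z) ≡ k * (1ℤ + (d + q)) - (1ℤ + (z + k * q))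
        ring₂ = solve-∀

minimal : ∀ {A : Set} (_⊑_ : A → A → Set) → (∀ x → x ⊑ x) → (∀ {x y z} → x ⊑ y → y ⊑ z → x ⊑ z) →
  (∀ x y → x ⊑ y ⊎ y ⊑ x) → ∀ x l → Σ A λ m → m ∈ (x ∷ l) × Each (m ⊑_) (x ∷ l)
minimal _⊑_ rf tr tot x [] = x , here refl , rf x ∷ []
minimal _⊑_ rf tr tot x (y ∷ l) = pick (minimal _⊑_ rf tr tot y l)
  where
  pick : (Σ _ λ m → m ∈ (y ∷ l) × Each (m ⊑_) (y ∷ l)) → Σ _ λ m → m ∈ (x ∷ y ∷ l) × Each (m ⊑_) (x ∷ y ∷ l)
  pick (m , m∈ , m⊑) = by (tot x m)
    where
    by : x ⊑ m ⊎ m ⊑ x → Σ _ λ m → m ∈ (x ∷ y ∷ l) × Each (m ⊑_) (x ∷ y ∷ l)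
    by (inj₁ x⊑m) = x , here refl , rf x ∷ Each.map (tr x⊑m) m⊑
    by (inj₂ m⊑x) = m , there m∈ , m⊑x ∷ m⊑

-- Density of the multiples of α

module Density (r : IrrationalReal) (r>1 : r >1) where
  open Cut r r>1
  open Group r r>1

  -- The interval [j , j + ε) modulo a N is hit by α (a x + s), with x ≡ c modulo N
  -- and |x| ≥ L: step through it with a multiple η of an irrational g < ε / (a N).
  Hit : (a N : ℤ) (c s j : ℤ) (L : ℕ) (e f : ℤ) → Set
  Hit a N c s j L e f = Σ ℤ λ y → Σ ℤ λ q → L ℕ.≤ ∣ c + N * y ∣ ×
    NN (- (j + a * N * q)) (a * (c + N * y) + s) ×
    PP (e + (j + a * N * q)) (f - (a * (c + N * y) + s))

  module Step (a′ N′ : ℕ) (c s j : ℤ) (L : ℕ) {e f p b : ℤ} (b≢0 : b ≢ 0ℤ) (g>0 : PP p b)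
    (g≤ε : NN (e - + (suc a′ ℕ.* suc N′) * p) (f - + (suc a′ ℕ.* suc N′) * b)) where
    a = + suc a′
    N = + suc N′
    aN≡ : + (suc a′ ℕ.* suc N′) ≡ a * N
    aN≡ = ℤP.pos-* (suc a′) (suc N′)
    η₁ = a * N * p
    η₂ = a * N * b
    η>0 : PP η₁ η₂
    η>0 = pp-by (pp-scale a′ (pp-scale N′ g>0)) (sym (ℤP.*-assoc a N p)) (sym (ℤP.*-assoc a N b))
    -- The point found is x = c - N n b with b ≠ 0, so -n ≥ L + |c| forces |x| ≥ L.
    K = + (L ℕ.+ ∣ c ∣)

    module _ (q₀ : ℕ) (q₀-large : NN (+ q₀ * 1ℤ - (K * η₁ - j)) (+ q₀ * 0ℤ - (K * η₂ + (a * c + s))))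
             (n : ℤ) where
      -- `D₁` + `D₂` α is the distance from α (a c + s) to a translate of j. Dividing its negative
      -- by η leaves a remainder in [0 , η), and η ≤ ε. The translate by a N `q₀` is taken so far
      -- away that the quotient n is at most -K.
      D₁ = j + a * N * + q₀
      D₂ = - (a * c + s)

      D-large : NN (D₁ - K * η₁) (D₂ - K * η₂)
      D-large = nn-by (nn-add q₀-large (nn-int (ℤP.i≤j⇒0≤j-i q₀≤)))
          (ring₁ (+ q₀) (K * η₁) j (a * N * + q₀)) (ring₂ (+ q₀) (K * η₂) (a * c + s))
        where
        q₀≤ : + q₀ ≤ a * N * + q₀
        q₀≤ = subst₂ _≤_ refl (trans (ℤP.pos-* (suc a′ ℕ.* suc N′) q₀) (cong (_* + q₀) aN≡))
          (+≤+ (ℕP.m≤m+n q₀ _))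
        ring₁ : ∀ q k j w → q * 1ℤ - (k - j) + (w - q) ≡ j + w - k
        ring₁ = solve-∀
        ring₂ : ∀ q k w → q * 0ℤ - (k + w) + 0ℤ ≡ - w - k
        ring₂ = solve-∀

      hit : NN (- D₁ - n * η₁) (- D₂ - n * η₂) → PP ((1ℤ + n) * η₁ - - D₁) ((1ℤ + n) * η₂ - - D₂) →
        Hit a N c s j L e f
      hit below above = - n * b , + q₀ + n * p , L≤ ,
          nn-by below (ring₁ a N n p (+ q₀) j) (ring₂ a N n b c s) ,
          pp-by (pp-add g≤ε above)
            (trans (cong (λ k → e - k * p + ((1ℤ + n) * (a * N * p) - - (j + a * N * + q₀))) aN≡)
                   (ring₃ e (a * N) n p (+ q₀) j))
            (trans (cong (λ k → f - k * b + ((1ℤ + n) * (a * N * b) - - - (a * c + s))) aN≡)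
                   (ring₄ f a N n b c s))
        where
        K≤ : K ≤ - n
        K≤ with K ≤? - n
        ... | yes q = q
        ... | no ¬q = ⊥-elim (pp-absurd (pp-add D-large (pp-add below
                  (pp-add (nn-scaleℤ (ℤP.i≤j⇒0≤j-i (≰⇒1+≤ ¬q)) (pp⇒nn η>0)) η>0)))
                  (ring₅ D₁ K n η₁) (ring₅ D₂ K n η₂))
          where ring₅ : ∀ D K n η → D - K * η + (- D - n * η + ((K - (1ℤ + - n)) * η + η)) ≡ 0ℤ
                ring₅ = solve-∀
        ring₁ : ∀ a N n p q j → - (j + a * N * q) - n * (a * N * p) ≡ - (j + a * N * (q + n * p))
        ring₁ = solve-∀
        ring₂ : ∀ a N n b c s → - - (a * c + s) - n * (a * N * b) ≡ a * (c + N * (- n * b)) + s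
        ring₂ = solve-∀
        ring₃ : ∀ e w n p q j → e - w * p + ((1ℤ + n) * (w * p) - - (j + w * q)) ≡ e + (j + w * (q + n * p))
        ring₃ = solve-∀
        ring₄ : ∀ f a N n b c s → f - a * N * b + ((1ℤ + n) * (a * N * b) - - - (a * c + s))
          ≡ f - (a * (c + N * (- n * b)) + s)
        ring₄ = solve-∀
        ring₆ : ∀ c w → c + w + - c ≡ w
        ring₆ = solve-∀
        1≤∣b∣ : 1 ℕ.≤ ∣ b ∣
        1≤∣b∣ = ℕP.n≢0⇒n>0 λ e → b≢0 (ℤP.∣i∣≡0⇒i≡0 e)
        open ℕP.≤-Reasoning
        L≤ : L ℕ.≤ ∣ c + N * (- n * b) ∣
        L≤ = ℕP.+-cancelʳ-≤ ∣ c ∣ L _ (begin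
          L ℕ.+ ∣ c ∣                          ≤⟨ ℤP.drop‿+≤+ (≤-trans K≤ (i≤+∣i∣ (- n))) ⟩
          ∣ - n ∣                              ≡⟨ ℕP.*-identityʳ _ ⟨
          ∣ - n ∣ ℕ.* 1                        ≤⟨ ℕP.*-monoʳ-≤ ∣ - n ∣ 1≤∣b∣ ⟩
          ∣ - n ∣ ℕ.* ∣ b ∣                    ≡⟨ ℤP.abs-* (- n) b ⟨
          ∣ - n * b ∣                          ≤⟨ ℕP.m≤m+n _ _ ⟩
          suc N′ ℕ.* ∣ - n * b ∣               ≡⟨ ℤP.abs-* N (- n * b) ⟨
          ∣ N * (- n * b) ∣                    ≡⟨ cong ∣_∣ (ring₆ c (N * (- n * b))) ⟨
          ∣ c + N * (- n * b) + - c ∣          ≤⟨ ℤP.∣i+j∣≤∣i∣+∣j∣ (c + N * (- n * b)) (- c) ⟩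
          ∣ c + N * (- n * b) ∣ ℕ.+ ∣ - c ∣    ≡⟨ cong (∣ c + N * (- n * b) ∣ ℕ.+_) (ℤP.∣-i∣≡∣i∣ c) ⟩
          ∣ c + N * (- n * b) ∣ ℕ.+ ∣ c ∣      ∎)

    result : Hit a N c s j L e f
    result =
      let q₀ , large = arch (K * η₁ - j) (K * η₂ + (a * c + s)) pp-1
          n , below , above = floor (- D₁ q₀ large 0ℤ) (- D₂ q₀ large 0ℤ) η>0
      in hit q₀ large n below above

  abstract
    density : ∀ a N c s j L {e f} → PP e f → Hit (+ suc a) (+ suc N) c s j L e f
    density a N c s j L {e} {f} ε>0 =
      let p , b , b≢0 , g>0 , g≤ε = small-multiple ε>0 (suc a ℕ.* suc N)
      in Step.result a N c s j L {e} {f} b≢0 g>0 g≤ε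

  common-ε : ∀ {A : Set} (m : A → ℕ) (g h : A → ℤ) → (∀ x → PP (g x) (h x)) → ∀ l →
    Σ ℤ λ e → Σ ℤ λ f → PP e f × Each (λ x → NN (g x - + m x * e) (h x - + m x * f)) l
  common-ε m g h gap>0 [] = 1ℤ , 0ℤ , pp-1 , []
  common-ε m g h gap>0 (x ∷ l) =
    let e , f , ε>0 , small-l = common-ε m g h gap>0 l
        p , b , _ , δ>0 , small-x = small-multiple (gap>0 x) (m x)
    in choose ε>0 small-l δ>0 small-x (NN? (e - p) (f - b))
    where
    lower : ∀ {u v e f p b} n → NN (u - + n * e) (v - + n * f) → NN (e - p) (f - b) → NN (u - + n * p) (v - + n * b)
    lower {u} {v} {e} {f} {p} {b} n small d = nn-by (nn-add small (nn-scale n d)) (ring₁ u (+ n) e p) (ring₁ v (+ n) f b)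
      where ring₁ : ∀ u n e p → u - n * e + n * (e - p) ≡ u - n * p
            ring₁ = solve-∀
    choose : ∀ {e f p b} → PP e f → Each (λ x → NN (g x - + m x * e) (h x - + m x * f)) l →
      PP p b → NN (g x - + m x * p) (h x - + m x * b) → Dec (NN (e - p) (f - b)) →
      Σ ℤ λ e → Σ ℤ λ f → PP e f × Each (λ x → NN (g x - + m x * e) (h x - + m x * f)) (x ∷ l)
    choose {e} {f} {p} {b} _ small-l δ>0 small-x (yes δ≤ε) =
      p , b , δ>0 , small-x ∷ Each.map (λ {y} q → lower {g y} {h y} {e} {f} {p} {b} (m y) q δ≤ε) small-l
    choose {e} {f} {p} {b} ε>0 small-l _ small-x (no ¬δ≤ε) =
      e , f , ε>0 , lower {g x} {h x} {p} {b} {e} {f} (m x) small-x (nn-by (¬NN⇒NN- ¬δ≤ε) (ring₁ e p) (ring₁ f b)) ∷ small-l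
      where ring₁ : ∀ e p → - (e - p) ≡ p - e
            ring₁ = solve-∀

  -- The value ⌊(a′ j + α u) / a⌋, u = a s′ − a′ s, which F (a′ x + s′) takes if α (a x + s)
  -- lies just to the right of the integer j.
  F-right : (k : ℕ) (s j : ℤ) (k′ : ℕ) (s′ : ℤ) → ℤ
  F-right k s j k′ s′ = (+ suc k′ * j + F (+ suc k * s′ - + suc k′ * s)) ÷ k

  F-right-+ : ∀ k s j q k′ s′ → F-right k s (j + + suc k * q) k′ s′ ≡ F-right k s j k′ s′ + + suc k′ * q
  F-right-+ k s j q k′ s′ = trans (cong (_÷ k) (ring₁ (+ suc k′) j (+ suc k) q (F (+ suc k * s′ - + suc k′ * s))))
      (÷-+* (+ suc k′ * j + F (+ suc k * s′ - + suc k′ * s)) k (+ suc k′ * q))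
    where ring₁ : ∀ b j a q f → b * (j + a * q) + f ≡ b * j + f + a * (b * q)
          ring₁ = solve-∀

  -- With a = k + 1 and a′ = k′ + 1, this is a times the distance from (a′ j + α u) / a to the next
  -- integer above it.
  gap : ∀ k s j k′ s′ → PP (+ suc k * (1ℤ + F-right k s j k′ s′) - + suc k′ * j) (- (+ suc k * s′ - + suc k′ * s))
  gap k s j k′ s′ = F<⇒pp (≤-by (÷-upper _ k) (ring₁ (+ suc k′ * j) (F (+ suc k * s′ - + suc k′ * s))
      (+ suc k * (1ℤ + F-right k s j k′ s′))))
    where ring₁ : ∀ b f z → z - (1ℤ + (b + f)) ≡ z - b - (1ℤ + f)
          ring₁ = solve-∀

  -- Moving α (a x + s) from j to the right by less than ε moves α (a′ x + s′) to the right by less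
  -- than a′ ε / a, and the first hypothesis keeps this within the gap.
  F-near : ∀ k s j k′ s′ x {e f} →
    NN (+ suc k * (1ℤ + F-right k s j k′ s′) - + suc k′ * j - + suc k′ * e)
       (- (+ suc k * s′ - + suc k′ * s) - + suc k′ * f) →
    NN (- j) (+ suc k * x + s) → PP (e + j) (f - (+ suc k * x + s)) →
    F (+ suc k′ * x + s′) ≡ F-right k s j k′ s′
  F-near k s j k′ s′ x {e} {f} ε-small lower upper = F-unique
      (nn-cancel k (nn-by (nn-add (nn-scale (suc k′) lower) (≤F⇒nn (≤-by (÷-lower (+ suc k′ * j + F u) k)
                      (ring₁ (+ suc k′ * j) (F u) (+ suc k * R)))))
                     (ring₂ (+ suc k′) j (+ suc k) R) (ring₃ (+ suc k) (+ suc k′) x s s′)))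
      (pp-cancel (suc k) (pp-by (pp-add ε-small (pp-scale k′ upper))
        (ring₄ (+ suc k) (+ suc k′) R j e) (ring₅ (+ suc k) (+ suc k′) x s s′ f)))
    where
    R = F-right k s j k′ s′
    u = + suc k * s′ - + suc k′ * s
    ring₁ : ∀ b f z → b + f - z ≡ f - (z - b)
    ring₁ = solve-∀
    ring₂ : ∀ b j a R → b * - j + - (a * R - b * j) ≡ a * - R
    ring₂ = solve-∀
    ring₃ : ∀ a b x s s′ → b * (a * x + s) + (a * s′ - b * s) ≡ a * (b * x + s′)
    ring₃ = solve-∀
    ring₄ : ∀ a b R j e → a * (1ℤ + R) - b * j - b * e + b * (e + j) ≡ a * (1ℤ + R)
    ring₄ = solve-∀
    ring₅ : ∀ a b x s s′ f → - (a * s′ - b * s) - b * f + b * (f - (a * x + s)) ≡ a * - (b * x + s′)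
    ring₅ = solve-∀

  -- Points (k , s) stand for linear forms (k+1) x + s.
  abstract
    hit-points : ∀ k N c s j L (l : List (ℕ × ℤ)) → Σ ℤ λ y → Σ ℤ λ q →
      L ℕ.≤ ∣ c + + suc N * y ∣ ×
      Each (λ (k′ , s′) → F (+ suc k′ * (c + + suc N * y) + s′) ≡
              F-right k s j k′ s′ + + suc k′ * (+ suc N * q)) l
    hit-points k N c s j L l =
      let e , f , ε>0 , small-l = common-ε (λ (k′ , _) → suc k′) _ _ (λ (k′ , s′) → gap k s j k′ s′) l
          y , q , L≤ , below , above = density k N c s j L ε>0
          -- Density reaches j only up to a multiple of (k+1) (N+1). Such a translation leaves every
          -- gap unchanged, so the ε chosen for j serves `J` as well.
          J = j + + suc k * + suc N * q
          J≡ = cong (λ z → j + z) (ℤP.*-assoc (+ suc k) (+ suc N) q)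
      in y , q , L≤ , Each.map (λ { {k′ , s′} sm →
           trans (F-near k s J k′ s′ (c + + suc N * y)
                    (nn-by sm (shift k s j k′ s′ (+ suc N * q) e J≡) refl) below above)
                 (trans (cong (λ J → F-right k s J k′ s′) J≡) (F-right-+ k s j (+ suc N * q) k′ s′)) }) small-l
      where
      shift : ∀ k s j k′ s′ q e {J} → J ≡ j + + suc k * q →
        + suc k * (1ℤ + F-right k s j k′ s′) - + suc k′ * j - + suc k′ * e ≡
        + suc k * (1ℤ + F-right k s J k′ s′) - + suc k′ * J - + suc k′ * e
      shift k s j k′ s′ q e refl = trans (ring₁ (+ suc k) (F-right k s j k′ s′) (+ suc k′) j q e)
          (cong (λ R → + suc k * (1ℤ + R) - + suc k′ * (j + + suc k * q) - + suc k′ * e)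
            (sym (F-right-+ k s j q k′ s′)))
        where ring₁ : ∀ a R b j q e → a * (1ℤ + R) - b * j - b * e ≡ a * (1ℤ + (R + b * q)) - b * (j + a * q) - b * e
              ring₁ = solve-∀

  private
    -- {α y} / (k+1) ≤ {α y′} / (k′+1) for y = (k+1) x + s and y′ = (k′+1) x + s′
    Leftmost : ℤ → ℕ × ℤ → ℕ × ℤ → Set
    Leftmost x (k , s) (k′ , s′) =
      NN (- (+ suc k * F y′ - + suc k′ * F y)) (+ suc k * y′ - + suc k′ * y)
      where y = + suc k * x + s
            y′ = + suc k′ * x + s′

    leftmost-trans : ∀ x {p q t} → Leftmost x p q → Leftmost x q t → Leftmost x p t
    leftmost-trans x {k , s} {k′ , s′} {k″ , s″} m n = nn-cancel k′
      (nn-by (nn-add (nn-scale (suc k) n) (nn-scale (suc k″) m))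
        (ring₁ (+ suc k) (+ suc k′) (+ suc k″) (F (+ suc k * x + s)) (F (+ suc k′ * x + s′)) (F (+ suc k″ * x + s″)))
        (ring₂ (+ suc k) (+ suc k′) (+ suc k″) (+ suc k * x + s) (+ suc k′ * x + s′) (+ suc k″ * x + s″)))
      where
      ring₁ : ∀ a b c u v w → a * - (b * w - c * v) + c * - (a * v - b * u) ≡ b * - (a * w - c * u)
      ring₁ = solve-∀
      ring₂ : ∀ a b c u v w → a * (b * w - c * v) + c * (a * v - b * u) ≡ b * (a * w - c * u)
      ring₂ = solve-∀

    leftmost-total : ∀ x p q → Leftmost x p q ⊎ Leftmost x q p
    leftmost-total x (k , s) (k′ , s′) = decide (NN? _ _)
      where
      y = + suc k * x + s
      y′ = + suc k′ * x + s′
      ring₁ : ∀ a b u v → - - (a * v - b * u) ≡ - (b * u - a * v)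
      ring₁ = solve-∀
      ring₂ : ∀ a b u v → - (a * v - b * u) ≡ b * u - a * v
      ring₂ = solve-∀
      decide : Dec (Leftmost x (k , s) (k′ , s′)) → Leftmost x (k , s) (k′ , s′) ⊎ Leftmost x (k′ , s′) (k , s)
      decide (yes p) = inj₁ p
      decide (no ¬p) = inj₂ (nn-by (¬NN⇒NN- ¬p) (ring₁ (+ suc k) (+ suc k′) (F y) (F y′))
                                               (ring₂ (+ suc k) (+ suc k′) y y′))

    leftmost-refl : ∀ x p → Leftmost x p p
    leftmost-refl x (k , s) = nn-by (nn-*α ≤-refl) (ring₁ (+ suc k * F y)) (ring₂ (+ suc k * y))
      where y = + suc k * x + s
            ring₁ : ∀ a → 0ℤ ≡ - (a - a)
            ring₁ = solve-∀
            ring₂ : ∀ a → 0ℤ ≡ a - a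
            ring₂ = solve-∀

    -- Slide α x to the left until α y is an integer, that is by {α y} / (k+1). Then α y′ moves by
    -- (k′+1) {α y} / (k+1) ≤ {α y′}, so its floor survives.
    leftmost-F : ∀ x k s k′ s′ → Leftmost x (k , s) (k′ , s′) →
      F (+ suc k′ * x + s′) ≡ F-right k s (F (+ suc k * x + s)) k′ s′
    leftmost-F x k s k′ s′ m = sym (÷-unique
        (≤-by (nn⇒≤F (nn-by m refl (ring₁ (+ suc k) (+ suc k′) x s s′)))
          (ring₂ (+ suc k * F y′) (+ suc k′ * F y) (F u)))
        (≤-by (pp⇒F< {t = u} (pp-by (pp-add (nn-scale (suc k′) (F-lower y)) (pp-scale k (F-upper y′)))
                        refl (ring₃ (+ suc k) (+ suc k′) x s s′)))
          (ring₄ (+ suc k) (+ suc k′) (F y) (F y′) (F u))))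
      where
      y = + suc k * x + s
      y′ = + suc k′ * x + s′
      u = + suc k * s′ - + suc k′ * s
      ring₁ : ∀ a b x s s′ → a * (b * x + s′) - b * (a * x + s) ≡ a * s′ - b * s
      ring₁ = solve-∀
      ring₂ : ∀ a b f → f - (a - b) ≡ b + f - a
      ring₂ = solve-∀
      ring₃ : ∀ a b x s s′ → b * (a * x + s) + a * - (b * x + s′) ≡ - (a * s′ - b * s)
      ring₃ = solve-∀
      ring₄ : ∀ a b v w f → b * - v + a * (1ℤ + w) - (1ℤ + f) ≡ a * (1ℤ + w) - (1ℤ + (b * v + f))
      ring₄ = solve-∀

  abstract
    leftmost-point : ∀ x p l → Σ (ℕ × ℤ) λ (k , s) → (k , s) ∈ (p ∷ l) ×
      Each (λ (k′ , s′) → F (+ suc k′ * x + s′) ≡ F-right k s (F (+ suc k * x + s)) k′ s′) (p ∷ l)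
    leftmost-point x p l =
      let m , m∈ , least = minimal (Leftmost x) (leftmost-refl x)
                             (λ {p} {q} {t} → leftmost-trans x {p} {q} {t}) (leftmost-total x) p l
      in m , m∈ , Each.map (λ {q} → leftmost-F x (proj₁ m) (proj₂ m) (proj₁ q) (proj₂ q)) least

  -- Jumps of F and membership in P_r

  F-0 : F 0ℤ ≡ 0ℤ
  F-0 = F-unique (nn-*α ≤-refl) pp-1

  F-neg : ∀ t → t ≢ 0ℤ → F (- t) ≡ - 1ℤ - F t
  F-neg t t≢0 = F-unique (nn-by (pp⇒nn (F-upper t)) (ring₁ (F t)) refl)
      (pp-by (nn-irr t≢0 (F-lower t)) (ring₂ (F t)) (sym (ℤP.neg-involutive t)))
    where ring₁ : ∀ f → 1ℤ + f ≡ - (- 1ℤ - f)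
          ring₁ = solve-∀
          ring₂ : ∀ f → - f ≡ 1ℤ + (- 1ℤ - f)
          ring₂ = solve-∀

  F-*÷ : ∀ k t → F (+ suc k * t) ÷ k ≡ F t
  F-*÷ k t = ÷-unique
    (nn⇒≤F (nn-by (nn-scale (suc k) (F-lower t)) (ring₁ (+ suc k) (F t)) refl))
    (pp⇒F< {t = + suc k * t} (pp-by (pp-scale k (F-upper t)) refl (ring₁ (+ suc k) t)))
    where ring₁ : ∀ k f → k * - f ≡ - (k * f)
          ring₁ = solve-∀

  F-suc-≥ : ∀ t → F t ≤ F (1ℤ + t)
  F-suc-≥ t = nn⇒≤F (nn-by (nn-add nn-α (F-lower t)) (ℤP.+-identityˡ (- F t)) refl)

  F-suc-≤ : ∀ t → F (1ℤ + t) ≤ 1ℤ + F t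
  F-suc-≤ t = ≤-by (pp⇒F< {t = 1ℤ + t} (pp-by (pp-add nn-1-α (F-upper t)) refl (ring₁ t))) (ring₂ (F t) (F (1ℤ + t)))
    where ring₁ : ∀ t → - 1ℤ + - t ≡ - (1ℤ + t)
          ring₁ = solve-∀
          ring₂ : ∀ f g → 1ℤ + (1ℤ + f) - (1ℤ + g) ≡ 1ℤ + f - g
          ring₂ = solve-∀

  Jump : ℤ → Set
  Jump y = F (1ℤ + y) ≡ 1ℤ + F y

  jump? : ∀ y → Dec (Jump y)
  jump? y = F (1ℤ + y) ℤP.≟ 1ℤ + F y

  no-jump : ∀ {y} → ¬ Jump y → F (1ℤ + y) ≡ F y
  no-jump {y} ¬j = ≤-antisym
      (≤-by (ℤP.i<j⇒suc[i]≤j (ℤP.≤∧≢⇒< (F-suc-≤ y) ¬j)) (ring₁ (F y) (F (1ℤ + y)))) (F-suc-≥ y)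
    where ring₁ : ∀ f g → 1ℤ + f - (1ℤ + g) ≡ f - g
          ring₁ = solve-∀

  -- The integer reached by this jump is 0, corresponding to the excluded multiple n = 0.
  jump--1 : Jump (- 1ℤ)
  jump--1 = trans F-0 (cong (λ z → 1ℤ + z) { - 1ℤ} {F (- 1ℤ)} (sym (F-unique { - 1ℤ} { - 1ℤ} nn-1-α pp-α)))

  P⇒≢-1 : ∀ {y} → P r y → y ≢ - 1ℤ
  P⇒≢-1 (n , n≢0 , le , ¬le) refl = ≤-absurd₂ -n≤0 (ℤP.i<j⇒suc[i]≤j n<0) (ring₁ n)
    where
    ring₁ : ∀ n → 0ℤ - - n + (0ℤ - (1ℤ + n)) ≡ - 1ℤ
    ring₁ = solve-∀
    F1≡0 : F 1ℤ ≡ 0ℤ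
    F1≡0 = F-unique nn-α pp-1-α
    -n≤0 : - n ≤ 0ℤ
    -n≤0 = subst (- n ≤_) F1≡0 (nn⇒≤F (nn-by (nn {n} {1ℤ} le) (sym (ℤP.neg-involutive n)) refl))
    n<0 : n < 0ℤ
    n<0 = ℤP.≰⇒> λ 0≤n → ¬le (le-mul (nn-int 0≤n))

  -- Dividing y ≤ n r < y + 1 by r gives α y ≤ n < α (y + 1), where n ≠ 0 makes the first inequality
  -- strict; thus F passes n between y and y + 1.
  P⇒jump : ∀ {y} → P r y → Jump y
  P⇒jump {y} (n , n≢0 , le , ¬le) = trans F≥n (cong (λ z → 1ℤ + z) (sym F≡))
    where
    ¬nn : ¬ NN n (- (1ℤ + y))
    ¬nn q = ¬le (subst (λ z → LeMul r z n) (trans (ℤP.neg-involutive (1ℤ + y)) (ℤP.+-comm 1ℤ y)) (le-mul q))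
    n>αy : PP n (- y)
    n>αy = pp λ q → n≢0 (proj₁ (nn-antisym le′ q))
      where le′ : NN n (- y)
            le′ = nn (subst (λ z → LeMul r z n) (sym (ℤP.neg-involutive y)) le)
    F≥ : n ≤ F (1ℤ + y)
    F≥ = nn⇒≤F (nn-by (¬NN⇒NN- ¬nn) refl (ℤP.neg-involutive (1ℤ + y)))
    F< : 1ℤ + F y ≤ n
    F< = pp⇒F< n>αy
    F≡ : F y ≡ n - 1ℤ
    F≡ = ≤-antisym (≤-by F< (ring₁ n (F y))) (≤-by (≤-trans F≥ (F-suc-≤ y)) (ring₂ n (F y)))
      where ring₁ : ∀ n f → n - (1ℤ + f) ≡ n - 1ℤ - f
            ring₁ = solve-∀
            ring₂ : ∀ n f → 1ℤ + f - n ≡ f - (n - 1ℤ)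
            ring₂ = solve-∀
    F≥n : F (1ℤ + y) ≡ 1ℤ + (n - 1ℤ)
    F≥n = ≤-antisym (≤-trans (F-suc-≤ y) (≤-reflexive (cong (λ z → 1ℤ + z) F≡))) (≤-trans (≤-reflexive (ring₁ n)) F≥)
      where ring₁ : ∀ n → 1ℤ + (n - 1ℤ) ≡ n
            ring₁ = solve-∀

  -- The witness `1ℤ + F y` lies in (α y , α (y + 1)]; the right end could be attained only for y +
  -- 1 = 0.
  jump⇒P : ∀ {y} → Jump y → y ≢ - 1ℤ → P r y
  jump⇒P {y} j y≢-1 = n , n≢0 , subst (λ z → LeMul r z n) (ℤP.neg-involutive y) (le-mul (pp⇒nn (F-upper y))) ,
      λ le → 1+y≢0 (proj₂ (nn-antisym (≤F⇒nn {n} {1ℤ + y} (≤-reflexive (sym j)))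
        (nn-by (nn (subst (λ z → LeMul r z n) (ring₁ y) le)) (sym (ℤP.neg-involutive n)) refl)))
    where
    n = 1ℤ + F y
    ring₁ : ∀ y → y + 1ℤ ≡ - - (1ℤ + y)
    ring₁ = solve-∀
    ring₂ : ∀ y → y ≡ 1ℤ + y - 1ℤ
    ring₂ = solve-∀
    1+y≢0 : 1ℤ + y ≢ 0ℤ
    1+y≢0 e = y≢-1 (trans (ring₂ y) (cong (_- 1ℤ) e))
    n≢0 : n ≢ 0ℤ
    -- For n = 0 the bounds leave -1 ≤ y ≤ 0: -1 is excluded, and y = 0 contradicts α y < n.
    n≢0 e = pp-absurd (F-upper y) e (cong -_ (≤-antisym (≤-by -y≥0 (ring₄ y)) 0≤y))
      where
      ring₃ : ∀ y → 0ℤ - - (1ℤ + y) ≡ y - - 1ℤ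
      ring₃ = solve-∀
      ring₄ : ∀ y → 0ℤ - - - y ≡ 0ℤ - y
      ring₄ = solve-∀
      ring₅ : ∀ y → y - (1ℤ + - 1ℤ) ≡ y - 0ℤ
      ring₅ = solve-∀
      -y≥0 : - - y ≤ 0ℤ
      -y≥0 = le-mul (nn-by (pp⇒nn (F-upper y)) e refl)
      -1≤y : - 1ℤ ≤ y
      -1≤y = ≤-by (le-mul (nn-by (≤F⇒nn {n} {1ℤ + y} (≤-reflexive (sym j))) (cong -_ e) refl)) (ring₃ y)
      0≤y : 0ℤ ≤ y
      0≤y = ≤-by (ℤP.i<j⇒suc[i]≤j (ℤP.≤∧≢⇒< -1≤y λ e → y≢-1 (sym e))) (ring₅ y)

does⇒ : ∀ {A : Set} (d : Dec A) → does d ≡ true → A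
does⇒ (yes a) _ = a

∧-true : ∀ {a b} → a ≡ true → b ≡ true → (a ∧ᵇ b) ≡ true
∧-true refl refl = refl

∧-true⁻ : ∀ {a b} → (a ∧ᵇ b) ≡ true → a ≡ true × b ≡ true
∧-true⁻ {true} {true} _ = refl , refl

∨-true₁ : ∀ {a b} → a ≡ true → (a ∨ᵇ b) ≡ true
∨-true₁ refl = refl

∨-true₂ : ∀ {a b} → b ≡ true → (a ∨ᵇ b) ≡ true
∨-true₂ {true} refl = refl
∨-true₂ {false} refl = refl

∨-true⁻ : ∀ {a b} → (a ∨ᵇ b) ≡ true → a ≡ true ⊎ b ≡ true
∨-true⁻ {true} _ = inj₁ refl
∨-true⁻ {false} e = inj₂ e

-- Boolean combinations of periodic conditions

data BF (A : Set) : Set where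
  atom    : A → BF A
  const   : Bool → BF A
  inv     : BF A → BF A
  _&_ _∥_ : BF A → BF A → BF A

module _ {A : Set} where
  eval : BF A → (A → Bool) → Bool
  eval (atom a) v = v a
  eval (const b) v = b
  eval (inv φ) v = not (eval φ v)
  eval (φ & ψ) v = eval φ v ∧ᵇ eval ψ v
  eval (φ ∥ ψ) v = eval φ v ∨ᵇ eval ψ v

  atoms : BF A → List A
  atoms (atom a) = a ∷ []
  atoms (const b) = []
  atoms (inv φ) = atoms φ
  atoms (φ & ψ) = atoms φ ++ atoms ψ
  atoms (φ ∥ ψ) = atoms φ ++ atoms ψ

  eval-cong : ∀ {v w} φ → Each (λ a → v a ≡ w a) (atoms φ) → eval φ v ≡ eval φ w
  eval-cong (atom a) (e ∷ []) = e
  eval-cong (const b) _ = refl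
  eval-cong (inv φ) es = cong not (eval-cong φ es)
  eval-cong (φ & ψ) es = cong₂ _∧ᵇ_ (eval-cong φ (EachP.++⁻ˡ (atoms φ) es)) (eval-cong ψ (EachP.++⁻ʳ (atoms φ) es))
  eval-cong (φ ∥ ψ) es = cong₂ _∨ᵇ_ (eval-cong φ (EachP.++⁻ˡ (atoms φ) es)) (eval-cong ψ (EachP.++⁻ʳ (atoms φ) es))

  ⋁ : ∀ {I : Set} → List I → (I → BF A) → BF A
  ⋁ [] f = const false
  ⋁ (i ∷ l) f = f i ∥ ⋁ l f

  ⋁-intro : ∀ {I : Set} {l : List I} f v {i} → i ∈ l → eval (f i) v ≡ true → eval (⋁ l f) v ≡ true
  ⋁-intro f v (here refl) e = ∨-true₁ e
  ⋁-intro f v (there i∈) e = ∨-true₂ (⋁-intro f v i∈ e)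

  ⋁-elim : ∀ {I : Set} (l : List I) f v → eval (⋁ l f) v ≡ true → Σ I λ i → i ∈ l × eval (f i) v ≡ true
  ⋁-elim (i ∷ l) f v e with ∨-true⁻ e
  ... | inj₁ e = i , here refl , e
  ... | inj₂ e = let j , j∈ , e = ⋁-elim l f v e in j , there j∈ , e

module _ {A B : Set} where
  _>>=_ : BF A → (A → BF B) → BF B
  atom a >>= f = f a
  const b >>= f = const b
  inv φ >>= f = inv (φ >>= f)
  (φ & ψ) >>= f = (φ >>= f) & (ψ >>= f)
  (φ ∥ ψ) >>= f = (φ >>= f) ∥ (ψ >>= f)

  eval-bind : ∀ φ (f : A → BF B) v → eval (φ >>= f) v ≡ eval φ (λ a → eval (f a) v)
  eval-bind (atom a) f v = refl
  eval-bind (const b) f v = refl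
  eval-bind (inv φ) f v = cong not (eval-bind φ f v)
  eval-bind (φ & ψ) f v = cong₂ _∧ᵇ_ (eval-bind φ f v) (eval-bind ψ f v)
  eval-bind (φ ∥ ψ) f v = cong₂ _∨ᵇ_ (eval-bind φ f v) (eval-bind ψ f v)

-- A set of integers with period pred-period + 1.
record Periodic : Set where
  field
    pred-period : ℕ
    _∋_         : ℤ → Bool
    periodic    : ∀ z q → _∋_ (z + + suc pred-period * q) ≡ _∋_ z
open Periodic public

multiples : ℕ → Periodic
multiples k = record
  { pred-period = k
  ; _∋_ = λ z → does (+ suc k * (z ÷ k) ≟ z)
  ; periodic = λ z q → trans (cong (λ d → does (+ suc k * d ≟ z + + suc k * q)) (÷-+* z k q))
      (does-⇔ (mk⇔ (λ e → trans (ring₂ (+ suc k) (z ÷ k) q) (trans (cong (_- + suc k * q) e) (ring₃ z (+ suc k * q))))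
                   (λ e → trans (ring₁ (+ suc k) (z ÷ k) q) (cong (_+ + suc k * q) e))) (_ ≟ _) (_ ≟ _)) }
  where ring₂ : ∀ k d q → k * d ≡ k * (d + q) - k * q
        ring₂ = solve-∀
        ring₃ : ∀ z w → z + w - w ≡ z
        ring₃ = solve-∀
        ring₁ : ∀ k d q → k * (d + q) ≡ k * d + k * q
        ring₁ = solve-∀

multiples-∋ : ∀ k y → (multiples k ∋ (+ suc k * y)) ≡ true
multiples-∋ k y = dec-true (_ ≟ _) (cong (+ suc k *_) (÷-unique {z = + suc k * y} {k} ≤-refl (≤-by (+≤+ (s≤s (z≤n {k})))
    (ring₁ (+ suc k) y))))
  where ring₁ : ∀ k y → k - 1ℤ ≡ k * (1ℤ + y) - (1ℤ + k * y)
        ring₁ = solve-∀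

multiples-∋⁻ : ∀ k {z} → (multiples k ∋ z) ≡ true → z ≡ + suc k * (z ÷ k)
multiples-∋⁻ k e = sym (does⇒ (_ ≟ _) e)

-- A preimage of S under division with rounding. Every division by a coefficient is absorbed into
-- the periodic set in this way; the period is multiplied by k + 1.
dilate : Periodic → ℕ → ℤ → Periodic
dilate S k b = record
  { pred-period = pred-period S ℕ.+ k ℕ.* suc (pred-period S)
  ; _∋_ = λ z → S ∋ ((b + z) ÷ k)
  ; periodic = λ z q → trans (cong (S ∋_) (trans (cong (_÷ k) (eq₁ z q))
      (÷-+* (b + z) k (+ suc (pred-period S) * q)))) (periodic S ((b + z) ÷ k) q) }
  where
  ring₁ : ∀ b z k m q → b + (z + k * m * q) ≡ b + z + k * (m * q)
  ring₁ = solve-∀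
  eq₁ : ∀ z q → b + (z + + suc (pred-period S ℕ.+ k ℕ.* suc (pred-period S)) * q) ≡
    b + z + + suc k * (+ suc (pred-period S) * q)
  eq₁ z q = trans (cong (λ m → b + (z + m * q)) (ℤP.pos-* (suc k) (suc (pred-period S))))
                  (ring₁ b z (+ suc k) (+ suc (pred-period S)) q)

-- This encodes ⌊-z⌋ = -1 - ⌊z⌋, valid for nonintegral z.
reflect : Periodic → Periodic
reflect S = record
  { pred-period = pred-period S
  ; _∋_ = λ z → S ∋ (- 1ℤ - z)
  ; periodic = λ z q → trans (cong (S ∋_) (ring₁ z (+ suc (pred-period S)) q)) (periodic S (- 1ℤ - z) (- q)) }
  where ring₁ : ∀ z m q → - 1ℤ - (z + m * q) ≡ - 1ℤ - z + m * - q
        ring₁ = solve-∀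

even-suc : ∀ z → (multiples 1 ∋ (1ℤ + z)) ≡ not (multiples 1 ∋ z)
even-suc z with + 2 * (z ÷ 1) ≟ z
... | yes e = dec-false (_ ≟ _) λ e′ → ≤-absurd (≤-reflexive {1ℤ + z} (trans (sym e′) (trans (cong (+ 2 *_) half) e)))
    (ring₁ z)
  where
  ring₁ : ∀ z → z - (1ℤ + z) ≡ - 1ℤ
  ring₁ = solve-∀
  ring₂ : ∀ z d → 1ℤ - 0ℤ + (z - + 2 * d) ≡ 1ℤ + z - + 2 * d
  ring₂ = solve-∀
  ring₃ : ∀ z d → + 2 * d - z ≡ + 2 * (1ℤ + d) - (1ℤ + (1ℤ + z))
  ring₃ = solve-∀
  half : (1ℤ + z) ÷ 1 ≡ z ÷ 1
  half = ÷-unique (≤-by₂ (+≤+ {0} {1} z≤n) (≤-reflexive e) (ring₂ z (z ÷ 1)))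
                  (≤-by (≤-reflexive (sym e)) (ring₃ z (z ÷ 1)))
... | no ne = trans (cong (multiples 1 ∋_) 1+z≡) (multiples-∋ 1 (1ℤ + z ÷ 1))
  where
  1+z≡ : 1ℤ + z ≡ + 2 * (1ℤ + z ÷ 1)
  1+z≡ = ≤-antisym (÷-upper z 1) (≤-by (ℤP.i<j⇒suc[i]≤j (ℤP.≤∧≢⇒< (÷-lower z 1) ne)) (ring₁ z (z ÷ 1)))
    where ring₁ : ∀ z d → z - (1ℤ + + 2 * d) ≡ 1ℤ + z - + 2 * (1ℤ + d)
          ring₁ = solve-∀

remainder : ∀ z k → Σ ℕ λ c → c ℕ.< suc k × Σ ℤ λ q → z ≡ + c + + suc k * q
remainder z k = z %ℕ suc k , n%ℕd<d z (suc k) , z /ℕ suc k ,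
  trans (a≡a%ℕn+[a/ℕn]*n z (suc k)) (cong (λ w → + (z %ℕ suc k) + w) (ℤP.*-comm (z /ℕ suc k) (+ suc k)))

-- Linear terms in the variable to be eliminated

module _ {n : ℕ} where
  infixl 7 _·_

  _·ℕ_ : ℕ → Term n → Term n
  zero ·ℕ t = zer
  suc k ·ℕ t = t ⊕ (k ·ℕ t)

  _·_ : ℤ → Term n → Term n
  (+ k) · t = k ·ℕ t
  -[1+ k ] · t = ⊖ (suc k ·ℕ t)

  num : ℤ → Term n
  num z = z · one

  ⟦·ℕ⟧ : ∀ k t ρ → ⟦ k ·ℕ t ⟧t ρ ≡ + k * ⟦ t ⟧t ρ
  ⟦·ℕ⟧ zero t ρ = refl
  ⟦·ℕ⟧ (suc k) t ρ = trans (cong (λ w → ⟦ t ⟧t ρ + w) (⟦·ℕ⟧ k t ρ)) (sym (ℤP.suc-* (+ k) (⟦ t ⟧t ρ)))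

  ⟦·⟧ : ∀ z t ρ → ⟦ z · t ⟧t ρ ≡ z * ⟦ t ⟧t ρ
  ⟦·⟧ (+ k) t ρ = ⟦·ℕ⟧ k t ρ
  ⟦·⟧ -[1+ k ] t ρ = trans (cong -_ (⟦·ℕ⟧ (suc k) t ρ)) (ℤP.neg-distribˡ-* (+ suc k) (⟦ t ⟧t ρ))

  ⟦num⟧ : ∀ z ρ → ⟦ num z ⟧t ρ ≡ z
  ⟦num⟧ z ρ = trans (⟦·⟧ z one ρ) (ℤP.*-identityʳ z)

  coeff : Term (suc n) → ℤ
  coeff (var Fin.zero) = 1ℤ
  coeff (var (Fin.suc i)) = 0ℤ
  coeff zer = 0ℤ
  coeff one = 0ℤ
  coeff (s ⊕ t) = coeff s + coeff t
  coeff (⊖ t) = - coeff t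

  rest : Term (suc n) → Term n
  rest (var Fin.zero) = zer
  rest (var (Fin.suc i)) = var i
  rest zer = zer
  rest one = one
  rest (s ⊕ t) = rest s ⊕ rest t
  rest (⊖ t) = ⊖ rest t

  ⟦split⟧ : ∀ t x (ρ : Env n) → ⟦ t ⟧t (extend x ρ) ≡ coeff t * x + ⟦ rest t ⟧t ρ
  ⟦split⟧ (var Fin.zero) x ρ = ring₁ x
    where ring₁ : ∀ x → x ≡ 1ℤ * x + 0ℤ
          ring₁ = solve-∀
  ⟦split⟧ (var (Fin.suc i)) x ρ = ring₁ x (ρ i)
    where ring₁ : ∀ x a → a ≡ 0ℤ * x + a
          ring₁ = solve-∀
  ⟦split⟧ zer x ρ = ring₁ x 0ℤ
    where ring₁ : ∀ x a → a ≡ 0ℤ * x + a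
          ring₁ = solve-∀
  ⟦split⟧ one x ρ = ring₁ x 1ℤ
    where ring₁ : ∀ x a → a ≡ 0ℤ * x + a
          ring₁ = solve-∀
  ⟦split⟧ (s ⊕ t) x ρ = trans (cong₂ _+_ (⟦split⟧ s x ρ) (⟦split⟧ t x ρ))
      (ring₁ (coeff s) (coeff t) x (⟦ rest s ⟧t ρ) (⟦ rest t ⟧t ρ))
    where ring₁ : ∀ a b x s t → a * x + s + (b * x + t) ≡ (a + b) * x + (s + t)
          ring₁ = solve-∀
  ⟦split⟧ (⊖ t) x ρ = trans (cong -_ (⟦split⟧ t x ρ)) (ring₁ (coeff t) x (⟦ rest t ⟧t ρ))
    where ring₁ : ∀ a x s → - (a * x + s) ≡ - a * x + - s
          ring₁ = solve-∀

data Atom (n : ℕ) : Set where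
  isZero : Term n → Atom n
  val    : Periodic → Term n → Atom n
  floorα : Periodic → Term n → Atom n

-- Virtual substitution

-- Atoms on the eliminated variable x and the remaining ones: (k+1) x + s = 0,
-- a x + s ∈ S and ⌊α ((k+1) x + s)⌋ ∈ S.
data XAtom (n : ℕ) : Set where
  xzero  : ℕ → Term n → XAtom n
  xval   : Periodic → ℤ → Term n → XAtom n
  xfloor : Periodic → ℕ → Term n → XAtom n
  param  : Atom n → XAtom n

pred-* : ℕ → ℕ → ℕ
pred-* m N = N ℕ.+ m ℕ.* suc N

module _ {n : ℕ} where
  -- Coefficients under a floor are made positive so that all arcs are closed on the left. A sign
  -- change of the argument y costs `reflect`, except at y = 0, where the floor is 0 and the case is
  -- split off by an equation.
  orient : Atom (suc n) → BF (XAtom n)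
  orient (isZero t) with coeff t
  ... | + 0 = atom (param (isZero (rest t)))
  ... | + suc k = atom (xzero k (rest t))
  ... | -[1+ k ] = atom (xzero k (⊖ rest t))
  orient (val S t) = atom (xval S (coeff t) (rest t))
  orient (floorα S t) with coeff t
  ... | + 0 = atom (param (floorα S (rest t)))
  ... | + suc k = atom (xfloor S k (rest t))
  ... | -[1+ k ] = (atom (xzero k (⊖ rest t)) & const (S ∋ 0ℤ)) ∥
                   (inv (atom (xzero k (⊖ rest t))) & atom (xfloor (reflect S) k (⊖ rest t)))

  zeros floors : List (XAtom n) → List (ℕ × Term n)
  zeros [] = []
  zeros (xzero k s ∷ l) = (k , s) ∷ zeros l
  zeros (xval _ _ _ ∷ l) = zeros l
  zeros (xfloor _ _ _ ∷ l) = zeros l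
  zeros (param _ ∷ l) = zeros l
  floors [] = []
  floors (xzero _ _ ∷ l) = floors l
  floors (xval _ _ _ ∷ l) = floors l
  floors (xfloor _ k s ∷ l) = (k , s) ∷ floors l
  floors (param _ ∷ l) = floors l

  AtZero AtFloor : (ℕ × Term n → Set) → XAtom n → Set
  AtZero Q (xzero k s) = Q (k , s)
  AtZero Q _ = ⊤
  AtFloor Q (xfloor _ k s) = Q (k , s)
  AtFloor Q _ = ⊤

  each-zero : ∀ {Q} l → Each Q (zeros l) → Each (AtZero Q) l
  each-zero [] _ = []
  each-zero (xzero k s ∷ l) (q ∷ qs) = q ∷ each-zero l qs
  each-zero (xval _ _ _ ∷ l) qs = _ ∷ each-zero l qs
  each-zero (xfloor _ _ _ ∷ l) qs = _ ∷ each-zero l qs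
  each-zero (param _ ∷ l) qs = _ ∷ each-zero l qs

  each-floor : ∀ {Q} l → Each Q (floors l) → Each (AtFloor Q) l
  each-floor [] _ = []
  each-floor (xzero k s ∷ l) qs = _ ∷ each-floor l qs
  each-floor (xval _ _ _ ∷ l) qs = _ ∷ each-floor l qs
  each-floor (xfloor _ _ _ ∷ l) (q ∷ qs) = q ∷ each-floor l qs
  each-floor (param _ ∷ l) qs = _ ∷ each-floor l qs

  HasPeriod : ℕ → XAtom n → Set
  HasPeriod N (xval S _ _) = ∀ z q → (S ∋ (z + + suc N * q)) ≡ (S ∋ z)
  HasPeriod N (xfloor S _ _) = ∀ z q → (S ∋ (z + + suc N * q)) ≡ (S ∋ z)
  HasPeriod N _ = ⊤

  period-of : XAtom n → ℕ
  period-of (xval S _ _) = pred-period S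
  period-of (xfloor S _ _) = pred-period S
  period-of _ = 0

  common-period : List (XAtom n) → ℕ
  common-period [] = 0
  common-period (a ∷ l) = pred-* (period-of a) (common-period l)

  private
    factorˡ : ∀ m N q → + suc (pred-* m N) * q ≡ + suc m * (+ suc N * q)
    factorˡ m N q = trans (cong (_* q) (ℤP.pos-* (suc m) (suc N))) (ℤP.*-assoc (+ suc m) (+ suc N) q)

    factorʳ : ∀ m N q → + suc (pred-* m N) * q ≡ + suc N * (+ suc m * q)
    factorʳ m N q = trans (factorˡ m N q) (ring₁ (+ suc m) (+ suc N) q)
      where ring₁ : ∀ m N q → m * (N * q) ≡ N * (m * q)
            ring₁ = solve-∀

    own-period : ∀ a N → HasPeriod (pred-* (period-of a) N) a
    own-period (xzero _ _) N = _
    own-period (xval S _ _) N z q =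
      trans (cong (λ w → S ∋ (z + w)) (factorˡ (pred-period S) N q)) (periodic S z _)
    own-period (xfloor S _ _) N z q =
      trans (cong (λ w → S ∋ (z + w)) (factorˡ (pred-period S) N q)) (periodic S z _)
    own-period (param _) N = _

    period-* : ∀ m N a → HasPeriod N a → HasPeriod (pred-* m N) a
    period-* m N (xzero _ _) h = _
    period-* m N (xval S _ _) h z q = trans (cong (λ w → S ∋ (z + w)) (factorʳ m N q)) (h z _)
    period-* m N (xfloor S _ _) h z q = trans (cong (λ w → S ∋ (z + w)) (factorʳ m N q)) (h z _)
    period-* m N (param _) h = _

  has-common-period : ∀ l → Each (HasPeriod (common-period l)) l
  has-common-period [] = []
  has-common-period (a ∷ l) = own-period a (common-period l) ∷
    Each.map (λ {b} → period-* (period-of a) (common-period l) b) (has-common-period l)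

  -- At x = -s / (k+1) this is (k+1) (a x + s′). It is also the argument u of F in `F-right`.
  cross : ℕ → Term n → ℤ → Term n → Term n
  cross k s a s′ = (+ suc k · s′) ⊕ (⊖ (a · s))

  ⟦cross⟧ : ∀ k s a s′ ρ → ⟦ cross k s a s′ ⟧t ρ ≡ + suc k * ⟦ s′ ⟧t ρ - a * ⟦ s ⟧t ρ
  ⟦cross⟧ k s a s′ ρ = cong₂ (λ u v → u - v) (⟦·⟧ (+ suc k) s′ ρ) (⟦·⟧ a s ρ)

  -- the substitution x = - s / (k+1)
  at-root : ℕ → Term n → XAtom n → BF (Atom n)
  at-root k s (xzero k′ s′) = atom (isZero (cross k s (+ suc k′) s′))
  at-root k s (xval S a s′) = atom (val (dilate S k 0ℤ) (cross k s a s′))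
  at-root k s (xfloor S k′ s′) = atom (floorα (dilate S k 0ℤ) (cross k s (+ suc k′) s′))
  at-root k s (param a) = atom a

  -- the substitution of a large x ≡ c modulo the periods for which α ((k+1) x + s)
  -- lies just to the right of an integer congruent to j
  right-of : ℕ → ℕ → Term n → ℕ → XAtom n → BF (Atom n)
  right-of c k s j (xzero k′ s′) = const false
  right-of c k s j (xval S a s′) = atom (val S (num (a * + c) ⊕ s′))
  -- This says that `F-right` lies in S; the numeral j moves into the offset of the periodic set.
  right-of c k s j (xfloor S k′ s′) = atom (floorα (dilate S k (+ suc k′ * + j)) (cross k s (+ suc k′) s′))
  right-of c k s j (param a) = atom a

  module _ (φ : BF (XAtom n)) where
    substitute-root : ℕ × Term n → BF (Atom n)
    substitute-root (k , s) = atom (val (multiples k) s) & (φ >>= at-root k s)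

    substitute-right-of : ℕ → ℕ × Term n → BF (Atom n)
    -- Changing j by (k+1) N changes `F-right` by (k′+1) N, by `F-right-+`; for N the common period
    -- this is invisible, so finitely many j suffice.
    substitute-right-of c (k , s) = ⋁ (upTo (suc k ℕ.* suc (common-period (atoms φ)))) λ j → φ >>= right-of c k s j

    substitute-large : ℕ → BF (Atom n)
    substitute-large c = ⋁ ((0 , zer) ∷ floors (atoms φ)) (substitute-right-of c)

    eliminate : BF (Atom n)
    eliminate = ⋁ (zeros (atoms φ)) substitute-root ∥ ⋁ (upTo (suc (common-period (atoms φ)))) substitute-large

module Elimination (r : IrrationalReal) (r>1 : r >1) where
  open Cut r r>1
  open Group r r>1
  open Density r r>1

  holds : ∀ {n} → Env n → Atom n → Bool
  holds ρ (isZero t) = does (⟦ t ⟧t ρ ≟ 0ℤ)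
  holds ρ (val S t) = S ∋ ⟦ t ⟧t ρ
  holds ρ (floorα S t) = S ∋ F (⟦ t ⟧t ρ)

  xholds : ∀ {n} → ℤ → Env n → XAtom n → Bool
  xholds x ρ (xzero k s) = does (+ suc k * x + ⟦ s ⟧t ρ ≟ 0ℤ)
  xholds x ρ (xval S a s) = S ∋ (a * x + ⟦ s ⟧t ρ)
  xholds x ρ (xfloor S k s) = S ∋ F (+ suc k * x + ⟦ s ⟧t ρ)
  xholds x ρ (param a) = holds ρ a

  module _ {n : ℕ} (ρ : Env n) where
    private
      V : Term n → ℤ
      V t = ⟦ t ⟧t ρ

      ≟0-cong : ∀ {i j} → (i ≡ 0ℤ → j ≡ 0ℤ) → (j ≡ 0ℤ → i ≡ 0ℤ) → does (i ≟ 0ℤ) ≡ does (j ≟ 0ℤ)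
      ≟0-cong f g = does-⇔ (mk⇔ f g) (_ ≟ _) (_ ≟ _)

    orient-correct : ∀ x a → eval (orient a) (xholds x ρ) ≡ holds (extend x ρ) a
    orient-correct x (isZero t) with coeff t | ⟦split⟧ t x ρ
    ... | + 0 | e = cong (λ z → does (z ≟ 0ℤ)) (sym (trans e (ring₁ x (V (rest t)))))
      where ring₁ : ∀ x s → 0ℤ * x + s ≡ s
            ring₁ = solve-∀
    ... | + suc k | e = cong (λ z → does (z ≟ 0ℤ)) (sym e)
    ... | -[1+ k ] | e = ≟0-cong
        (λ e′ → trans e (trans (ring₁ (+ suc k) x (V (rest t))) (cong -_ e′)))
        (λ e′ → trans (ring₂ (+ suc k) x (V (rest t))) (cong -_ (trans (sym e) e′)))
      where ring₁ : ∀ k x s → - k * x + s ≡ - (k * x - s)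
            ring₁ = solve-∀
            ring₂ : ∀ k x s → k * x - s ≡ - (- k * x + s)
            ring₂ = solve-∀
    orient-correct x (val S t) = cong (S ∋_) (sym (⟦split⟧ t x ρ))
    orient-correct x (floorα S t) with coeff t | ⟦split⟧ t x ρ
    ... | + 0 | e = cong (λ z → S ∋ F z) (sym (trans e (ring₁ x (V (rest t)))))
      where ring₁ : ∀ x s → 0ℤ * x + s ≡ s
            ring₁ = solve-∀
    ... | + suc k | e = cong (λ z → S ∋ F z) (sym e)
    ... | -[1+ k ] | e = trans (by-sign (+ suc k * x + V (⊖ rest t)))
        (cong (λ z → S ∋ F z) (trans (ring₁ (+ suc k) x (V (rest t))) (sym e)))
      where
      ring₁ : ∀ k x s → - (k * x - s) ≡ - k * x + s
      ring₁ = solve-∀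
      by-sign : ∀ y → ((does (y ≟ 0ℤ) ∧ᵇ (S ∋ 0ℤ)) ∨ᵇ (not (does (y ≟ 0ℤ)) ∧ᵇ (S ∋ (- 1ℤ - F y)))) ≡ (S ∋ F (- y))
      by-sign y with y ≟ 0ℤ
      ... | no ne = cong (S ∋_) (sym (F-neg y ne))
      ... | yes refl = trans (∨-identityʳ (S ∋ 0ℤ)) (cong (S ∋_) (sym F-0))

    at-root-correct : ∀ x k s → + suc k * x + V s ≡ 0ℤ → ∀ a → eval (at-root k s a) (holds ρ) ≡ xholds x ρ a
    at-root-correct x k s root = go
      where
      cross≡ : ∀ a s′ → V (cross k s a s′) ≡ + suc k * (a * x + V s′)
      cross≡ a s′ = trans (⟦cross⟧ k s a s′ ρ) (trans (ring₁ (+ suc k) x (V s) a (V s′))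
          (trans (cong (λ z → + suc k * (a * x + V s′) - a * z) root) (ring₂ (+ suc k * (a * x + V s′)) a)))
        where ring₁ : ∀ k x s a s′ → k * s′ - a * s ≡ k * (a * x + s′) - a * (k * x + s)
              ring₁ = solve-∀
              ring₂ : ∀ y a → y - a * 0ℤ ≡ y
              ring₂ = solve-∀
      cancel : ∀ y → (0ℤ + + suc k * y) ÷ k ≡ y
      cancel y = trans (÷-+* 0ℤ k y) (trans (cong (_+ y) 0÷) (ℤP.+-identityˡ y))
        where 0÷ : 0ℤ ÷ k ≡ 0ℤ
              0÷ = ÷-unique (≤-reflexive (ℤP.*-zeroʳ (+ suc k)))
                (≤-trans (+≤+ (s≤s (z≤n {k}))) (≤-reflexive (sym (ℤP.*-identityʳ (+ suc k)))))
      go : ∀ a → eval (at-root k s a) (holds ρ) ≡ xholds x ρ a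
      go (xzero k′ s′) = ≟0-cong
        (λ e → ℤP.*-cancelˡ-≡ (+ suc k) _ 0ℤ (trans (sym (cross≡ (+ suc k′) s′)) (trans e (sym (ℤP.*-zeroʳ (+ suc k))))))
        (λ e → trans (cross≡ (+ suc k′) s′) (trans (cong (+ suc k *_) e) (ℤP.*-zeroʳ (+ suc k))))
      go (xval S a s′) = cong (S ∋_) (trans (cong (λ z → (0ℤ + z) ÷ k) (cross≡ a s′)) (cancel _))
      go (xfloor S k′ s′) = cong (S ∋_) (trans (cong (_÷ k) (ℤP.+-identityˡ _))
        (trans (cong (λ z → F z ÷ k) (cross≡ (+ suc k′) s′)) (F-*÷ k _)))
      go (param a) = refl

    right-of-correct : ∀ N c k s j x y → x ≡ + c + + suc N * y → ∀ a → HasPeriod N a →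
      AtZero (λ (k′ , s′) → + suc k′ * x + V s′ ≢ 0ℤ) a →
      AtFloor (λ (k′ , s′) → Σ ℤ λ q →
        F (+ suc k′ * x + V s′) ≡ F-right k (V s) (+ j) k′ (V s′) + + suc N * q) a →
      eval (right-of c k s j a) (holds ρ) ≡ xholds x ρ a
    right-of-correct N c k s j x y x≡ (xzero k′ s′) _ ne _ = sym (dec-false (_ ≟ _) ne)
    right-of-correct N c k s j x y x≡ (xval S a s′) h _ _ =
      trans (cong (λ z → S ∋ (z + V s′)) (⟦num⟧ (a * + c) ρ))
        (trans (sym (h (a * + c + V s′) (a * y)))
          (cong (S ∋_) (trans (ring₁ a (+ c) (V s′) (+ suc N) y) (cong (λ z → a * z + V s′) (sym x≡)))))
      where ring₁ : ∀ a c s N y → a * c + s + N * (a * y) ≡ a * (c + N * y) + s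
            ring₁ = solve-∀
    right-of-correct N c k s j x y x≡ (xfloor S k′ s′) h _ (q , e) =
      trans (cong (λ z → S ∋ ((+ suc k′ * + j + F z) ÷ k)) (⟦cross⟧ k s (+ suc k′) s′ ρ))
        (trans (sym (h _ q)) (cong (S ∋_) (sym e)))
    right-of-correct N c k s j x y x≡ (param a) _ _ _ = refl

    zero-bound : ∀ (l : List (ℕ × Term n)) → Σ ℕ λ L → Each (λ (k , s) → ∣ V s ∣ ℕ.< L) l
    zero-bound [] = 0 , []
    zero-bound ((k , s) ∷ l) = let L , b = zero-bound l in suc ∣ V s ∣ ℕ.+ L ,
      ℕP.m≤m+n (suc ∣ V s ∣) L ∷ Each.map (λ lt → ℕP.≤-trans lt (ℕP.m≤n+m L (suc ∣ V s ∣))) b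

    large⇒≢0 : ∀ k x s → ∣ s ∣ ℕ.< ∣ x ∣ → + suc k * x + s ≢ 0ℤ
    large⇒≢0 k x s lt e = ℕP.<⇒≱ lt (ℕP.≤-trans (ℕP.m≤m+n ∣ x ∣ (k ℕ.* ∣ x ∣)) (ℕP.≤-reflexive
      (trans (sym (ℤP.abs-* (+ suc k) x)) (trans (cong ∣_∣ kx≡) (ℤP.∣-i∣≡∣i∣ s)))))
      where
      kx≡ : + suc k * x ≡ - s
      kx≡ = trans (ring₁ (+ suc k * x) s) (trans (cong (_- s) e) (ℤP.+-identityˡ (- s)))
        where ring₁ : ∀ w s → w ≡ w + s - s
              ring₁ = solve-∀

    module _ (φ : BF (XAtom n)) where
      private
        N = common-period (atoms φ)

      eliminate-sound : eval (eliminate φ) (holds ρ) ≡ true → Σ ℤ λ x → eval φ (xholds x ρ) ≡ true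
      eliminate-sound e with ∨-true⁻ e
      ... | inj₁ e₁ =
        let (k , s) , _ , e₂ = ⋁-elim (zeros (atoms φ)) (substitute-root φ) (holds ρ) e₁
            s∈ , e₃ = ∧-true⁻ e₂
            x = - (V s ÷ k)
            root = trans (cong (λ z → + suc k * x + z) (multiples-∋⁻ k s∈)) (ring₁ (+ suc k) (V s ÷ k))
        in x , trans (sym (trans (eval-bind φ (at-root k s) (holds ρ))
                                 (eval-cong φ (Each.universal (at-root-correct x k s root) (atoms φ))))) e₃
        where ring₁ : ∀ k y → k * - y + k * y ≡ 0ℤ
              ring₁ = solve-∀
      ... | inj₂ e₁ =
        let c , _ , e₂ = ⋁-elim (upTo (suc N)) (substitute-large φ) (holds ρ) e₁
            (k , s) , _ , e₃ = ⋁-elim ((0 , zer) ∷ floors (atoms φ)) (substitute-right-of φ c) (holds ρ) e₂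
            j , _ , e₄ = ⋁-elim (upTo (suc k ℕ.* suc N)) (λ j → φ >>= right-of c k s j) (holds ρ) e₃
            L , small = zero-bound (zeros (atoms φ))
            y , q , L≤ , hits = hit-points k N (+ c) (V s) (+ j) L (map (λ (k , s) → k , V s) (floors (atoms φ)))
            x = + c + + suc N * y
            apart = each-zero (atoms φ) (Each.map (λ { {k′ , s′} lt → large⇒≢0 k′ x (V s′) (ℕP.≤-trans lt L≤) }) small)
            values = each-floor (atoms φ) (Each.map (λ { {k′ , s′} h → + suc k′ * q ,
                       trans h (cong (λ z → F-right k (V s) (+ j) k′ (V s′) + z) (ring₁ (+ suc k′) (+ suc N) q)) })
                       (EachP.map⁻ hits))
        in x , trans (sym (trans (eval-bind φ (right-of c k s j) (holds ρ)) (eval-cong φ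
             (Each.map (λ { {a} (h , z , f) → right-of-correct N c k s j x y refl a h z f })
               (Each.zip (has-common-period (atoms φ) , Each.zip (apart , values))))))) e₄
        where ring₁ : ∀ k N q → k * (N * q) ≡ N * (k * q)
              ring₁ = solve-∀

      eliminate-complete : ∀ x → eval φ (xholds x ρ) ≡ true → eval (eliminate φ) (holds ρ) ≡ true
      eliminate-complete x e with any? (λ (k , s) → + suc k * x + V s ≟ 0ℤ) (zeros (atoms φ))
      ... | yes some = ∨-true₁ (by-root (find some))
        where
        ring₁ : ∀ k x s → s ≡ k * - x + (k * x + s)
        ring₁ = solve-∀
        by-root : (Σ (ℕ × Term n) λ p → p ∈ zeros (atoms φ) × + suc (proj₁ p) * x + V (proj₂ p) ≡ 0ℤ) →
          eval (⋁ (zeros (atoms φ)) (substitute-root φ)) (holds ρ) ≡ true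
        by-root ((k , s) , p∈ , root) = ⋁-intro (substitute-root φ) (holds ρ) p∈ (∧-true
          (trans (cong (multiples k ∋_) (trans (ring₁ (+ suc k) x (V s)) (trans (cong (λ z → + suc k * - x + z) root)
              (ℤP.+-identityʳ _)))) (multiples-∋ k (- x)))
          (trans (trans (eval-bind φ (at-root k s) (holds ρ))
            (eval-cong φ (Each.universal (at-root-correct x k s root) (atoms φ)))) e))
      ... | no none =
        let c , c< , y , x≡ = remainder x N
            p , p∈ , least = leftmost-point x (0 , V zer) (map (λ (k , s) → k , V s) (floors (atoms φ)))
            (k , s) , ks∈ , p≡ = ∈-map⁻ (λ (k , s) → k , V s) {xs = (0 , zer) ∷ floors (atoms φ)} p∈
        in ∨-true₂ {eval (⋁ (zeros (atoms φ)) (substitute-root φ)) (holds ρ)} (⋁-intro (substitute-large φ) (holds ρ) (∈-upTo⁺ c<) (⋁-intro (substitute-right-of φ c) (holds ρ) ks∈ (by-leftmost c y x≡ k s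
             (EachP.map⁻ (Each.tail (subst (λ p → Each (λ (k′ , s′) → F (+ suc k′ * x + s′) ≡
                F-right (proj₁ p) (proj₂ p) (F (+ suc (proj₁ p) * x + proj₂ p)) k′ s′) _) p≡ least))))))
        where
        by-leftmost : ∀ c y → x ≡ + c + + suc N * y → ∀ k s →
          Each (λ (k′ , s′) → F (+ suc k′ * x + V s′) ≡ F-right k (V s) (F (+ suc k * x + V s)) k′ (V s′))
            (floors (atoms φ)) →
          eval (substitute-right-of φ c (k , s)) (holds ρ) ≡ true
        by-leftmost c y x≡ k s least =
          let j , j< , q , j≡ = remainder (F (+ suc k * x + V s)) (pred-* k N)
              J≡ = trans j≡ (cong (λ z → + j + z) (factor k N q))
              values = each-floor (atoms φ) (Each.map (λ { {k′ , s′} h → + suc k′ * q ,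
                 trans h (trans (cong (λ J → F-right k (V s) J k′ (V s′)) J≡)
                   (trans (F-right-+ k (V s) (+ j) (+ suc N * q) k′ (V s′))
                     (cong (λ z → F-right k (V s) (+ j) k′ (V s′) + z) (ring₁ (+ suc k′) (+ suc N) q)))) }) least)
              apart = each-zero (atoms φ) (EachP.¬Any⇒All¬ _ none)
          in ⋁-intro (λ j → φ >>= right-of c k s j) (holds ρ) (∈-upTo⁺ j<) (trans (trans (eval-bind φ (right-of c k s j) (holds ρ)) (eval-cong φ
               (Each.map (λ { {a} (h , z , f) → right-of-correct N c k s j x y x≡ a h z f })
                 (Each.zip (has-common-period (atoms φ) , Each.zip (apart , values)))))) e)
          where
          ring₁ : ∀ k N q → k * (N * q) ≡ N * (k * q)
          ring₁ = solve-∀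
          factor : ∀ k N q → + suc (pred-* k N) * q ≡ + suc k * (+ suc N * q)
          factor k N q = trans (cong (_* q) (ℤP.pos-* (suc k) (suc N))) (ℤP.*-assoc (+ suc k) (+ suc N) q)

module Translation (r : IrrationalReal) (r>1 : r >1) where
  open Cut r r>1
  open Group r r>1
  open Density r r>1
  open Elimination r r>1

  even-jump : ∀ y → let a = multiples 1 ∋ F (1ℤ + y) ; b = multiples 1 ∋ F y in
    ((a ∧ᵇ not b) ∨ᵇ (not a ∧ᵇ b)) ≡ does (jump? y)
  even-jump y = by (jump? y)
    where
    differ : ∀ a b → a ≡ not b → ((a ∧ᵇ not b) ∨ᵇ (not a ∧ᵇ b)) ≡ true
    differ _ true refl = refl
    differ _ false refl = refl
    same : ∀ a b → a ≡ b → ((a ∧ᵇ not b) ∨ᵇ (not a ∧ᵇ b)) ≡ false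
    same _ true refl = refl
    same _ false refl = refl
    by : (d : Dec (Jump y)) → ((multiples 1 ∋ F (1ℤ + y)) ∧ᵇ not (multiples 1 ∋ F y)) ∨ᵇ
      (not (multiples 1 ∋ F (1ℤ + y)) ∧ᵇ (multiples 1 ∋ F y)) ≡ does d
    by (yes j) = differ _ _ (trans (cong (multiples 1 ∋_) j) (even-suc (F y)))
    by (no ¬j) = same _ _ (cong (multiples 1 ∋_) (no-jump ¬j))

  floorEven : ∀ {n} → ℕ → Term n → BF (Atom n)
  floorEven k t = atom (floorα (dilate (multiples 1) k 0ℤ) t)

  dplus : ∀ {n} → ℕ → Term n → BF (Atom n)
  dplus k t = atom (val (multiples k) t) & (inv (atom (isZero t′)) &
    ((floorEven k t′ & inv (floorEven k t)) ∥ (inv (floorEven k t′) & floorEven k t)))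
    where t′ = num (+ suc k) ⊕ t

  translate : ∀ {n} → Formula n → BF (Atom n)
  translate tt = const true
  translate ff = const false
  translate (s ≐ t) = atom (isZero (s ⊕ (⊖ t)))
  translate (D+ k t) = dplus k t
  translate (D- k t) = atom (val (multiples k) t) & inv (dplus k t)
  translate (~ φ) = inv (translate φ)
  translate (φ ∧ ψ) = translate φ & translate ψ
  translate (φ ∨ ψ) = translate φ ∥ translate ψ
  translate (Ex φ) = eliminate (translate φ >>= orient)
  translate (All φ) = inv (eliminate (inv (translate φ) >>= orient))

  module _ {n : ℕ} (ρ : Env n) where
    private
      V : Term n → ℤ
      V t = ⟦ t ⟧t ρ

    floorEven-correct : ∀ k t y → V t ≡ + suc k * y → eval (floorEven k t) (holds ρ) ≡ (multiples 1 ∋ F y)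
    floorEven-correct k t y e = cong (multiples 1 ∋_) (trans (cong (_÷ k) (ℤP.+-identityˡ (F (V t))))
      (trans (cong (λ z → F z ÷ k) e) (F-*÷ k y)))

    dplus-multiple : ∀ k t y → V t ≡ + suc k * y →
      eval (dplus k t) (holds ρ) ≡ (true ∧ᵇ (not (does (V (num (+ suc k) ⊕ t) ≟ 0ℤ)) ∧ᵇ does (jump? y)))
    dplus-multiple k t y e = cong₂ _∧ᵇ_ (trans (cong (multiples k ∋_) e) (multiples-∋ k y))
        (cong (not (does (V t′ ≟ 0ℤ)) ∧ᵇ_) (trans (cong₂ (λ a b → (a ∧ᵇ not b) ∨ᵇ (not a ∧ᵇ b))
          (floorEven-correct k t′ (1ℤ + y) e′) (floorEven-correct k t y e)) (even-jump y)))
      where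
      t′ = num (+ suc k) ⊕ t
      e′ : V t′ ≡ + suc k * (1ℤ + y)
      e′ = trans (cong₂ _+_ (⟦num⟧ (+ suc k) ρ) e) (ring₁ (+ suc k) y)
        where ring₁ : ∀ k y → k + k * y ≡ k * (1ℤ + y)
              ring₁ = solve-∀

    dplus-sound : ∀ k t → eval (dplus k t) (holds ρ) ≡ true → Dplus r (suc k) (V t)
    dplus-sound k t h =
      let m∣t , h₁ = ∧-true⁻ h
          y = V t ÷ k
          t≡ = multiples-∋⁻ k m∣t
          _ , h₂ = ∧-true⁻ {true} (trans (sym (dplus-multiple k t y t≡)) h)
          ne , j = ∧-true⁻ {not (does (V (num (+ suc k) ⊕ t) ≟ 0ℤ))} h₂
      in y , t≡ , jump⇒P (does⇒ (jump? y) j) λ y≡ → not-zero ne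
           (trans (cong₂ _+_ (⟦num⟧ (+ suc k) ρ) (trans t≡ (cong (+ suc k *_) y≡))) (ring₁ (+ suc k)))
      where
      ring₁ : ∀ k → k + k * - 1ℤ ≡ 0ℤ
      ring₁ = solve-∀
      not-zero : ∀ {z} → not (does (z ≟ 0ℤ)) ≡ true → z ≢ 0ℤ
      not-zero {z} e z≡0 with trans (sym e) (cong not (dec-true (z ≟ 0ℤ) z≡0))
      ... | ()

    dplus-complete : ∀ k t → Dplus r (suc k) (V t) → eval (dplus k t) (holds ρ) ≡ true
    dplus-complete k t (y , t≡ , p) = trans (dplus-multiple k t y t≡)
        (∧-true (cong not (dec-false (_ ≟ _) λ e → P⇒≢-1 p (ℤP.*-cancelˡ-≡ (+ suc k) y (- 1ℤ)
            (trans (sym t≡) (trans (ring₁ (+ suc k) (V t)) (trans (cong (λ z → + suc k * - 1ℤ + z)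
              (trans (cong (_+ V t) (sym (⟦num⟧ (+ suc k) ρ))) e)) (ℤP.+-identityʳ _)))))))
          (dec-true (jump? y) (P⇒jump p)))
      where ring₁ : ∀ k t → t ≡ k * - 1ℤ + (k + t)
            ring₁ = solve-∀

  ¬true⇒not : ∀ {b} → ¬ b ≡ true → not b ≡ true
  ¬true⇒not {true} h = contradiction refl h
  ¬true⇒not {false} _ = refl

  not⇒¬true : ∀ {b} → not b ≡ true → ¬ b ≡ true
  not⇒¬true {true} ()
  not⇒¬true {false} _ ()

  true-stable : ∀ {b} → ¬ ¬ b ≡ true → b ≡ true
  true-stable {true} _ = refl
  true-stable {false} h = contradiction (λ ()) h

  translate-sound : ∀ {n} (φ : Formula n) ρ → eval (translate φ) (holds ρ) ≡ true → Sat r φ ρ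
  translate-complete : ∀ {n} (φ : Formula n) ρ → Sat r φ ρ → eval (translate φ) (holds ρ) ≡ true

  oriented : ∀ {n} (φ : BF (Atom (suc n))) x ρ → eval (φ >>= orient) (xholds x ρ) ≡ eval φ (holds (extend x ρ))
  oriented φ x ρ = trans (eval-bind φ orient (xholds x ρ)) (eval-cong φ (Each.universal (orient-correct ρ x) (atoms φ)))

  translate-sound tt ρ h = _
  translate-sound (s ≐ t) ρ h = ℤP.i-j≡0⇒i≡j _ _ (does⇒ (_ ≟ _) h)
  translate-sound (D+ k t) ρ h = dplus-sound ρ k t h
  translate-sound (D- k t) ρ h =
    let m∣t , ¬h = ∧-true⁻ h
        t≡ = multiples-∋⁻ k m∣t
    in ⟦ t ⟧t ρ ÷ k , t≡ , λ p → not⇒¬true ¬h (dplus-complete ρ k t (_ , t≡ , p))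
  translate-sound (~ φ) ρ h s = not⇒¬true h (translate-complete φ ρ s)
  translate-sound (φ ∧ ψ) ρ h = let a , b = ∧-true⁻ h in translate-sound φ ρ a , translate-sound ψ ρ b
  translate-sound (φ ∨ ψ) ρ h (¬a , ¬b) with ∨-true⁻ {eval (translate φ) (holds ρ)} h
  ... | inj₁ a = ¬a (translate-sound φ ρ a)
  ... | inj₂ b = ¬b (translate-sound ψ ρ b)
  translate-sound (Ex φ) ρ h none =
    let x , e = eliminate-sound ρ (translate φ >>= orient) h
    in none x (translate-sound φ (extend x ρ) (trans (sym (oriented (translate φ) x ρ)) e))
  translate-sound (All φ) ρ h x = translate-sound φ (extend x ρ) (true-stable λ ¬s →
    not⇒¬true h (eliminate-complete ρ (inv (translate φ) >>= orient) x
      (trans (oriented (inv (translate φ)) x ρ) (¬true⇒not ¬s))))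

  translate-complete tt ρ _ = refl
  translate-complete (s ≐ t) ρ e = dec-true (_ ≟ _) (ℤP.i≡j⇒i-j≡0 e)
  translate-complete (D+ k t) ρ d = dplus-complete ρ k t d
  translate-complete (D- k t) ρ (y , t≡ , ¬p) = ∧-true
    (trans (cong (multiples k ∋_) t≡) (multiples-∋ k y))
    (¬true⇒not λ h → let y′ , t≡′ , p = dplus-sound ρ k t h in
      ¬p (subst (P r) (ℤP.*-cancelˡ-≡ (+ suc k) y′ y (trans (sym t≡′) t≡)) p))
  translate-complete (~ φ) ρ ¬s = ¬true⇒not λ h → ¬s (translate-sound φ ρ h)
  translate-complete (φ ∧ ψ) ρ (a , b) = ∧-true (translate-complete φ ρ a) (translate-complete ψ ρ b)
  translate-complete (φ ∨ ψ) ρ s = true-stable λ ¬h → s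
    ( (λ a → ¬h (∨-true₁ (translate-complete φ ρ a)))
    , (λ b → ¬h (∨-true₂ {eval (translate φ) (holds ρ)} (translate-complete ψ ρ b))))
  translate-complete (Ex φ) ρ s = true-stable λ ¬h → s λ x a →
    ¬h (eliminate-complete ρ (translate φ >>= orient) x
      (trans (oriented (translate φ) x ρ) (translate-complete φ (extend x ρ) a)))
  translate-complete (All φ) ρ s = ¬true⇒not λ h →
    let x , e = eliminate-sound ρ (inv (translate φ) >>= orient) h
    in not⇒¬true (trans (sym (oriented (inv (translate φ)) x ρ)) e) (translate-complete φ (extend x ρ) (s x))

-- Back to the language L±

module Thresholds (r : IrrationalReal) (r>1 : r >1) where
  open Cut r r>1
  open Group r r>1
  open Density r r>1

  -- {α v} ≥ i / (B+1), i.e. (B+1) F v + i ≤ F ((B+1) v), is equivalent to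
  -- {α v} ≥ 1 - {α K} for K with {α K} just above 1 - i / (B+1), except close to
  -- i / (B+1), where Jump ((B+1) v) tells the side; K′ bounds that exceptional range.
  record Threshold (B i : ℕ) : Set where
    field
      K T K′ T′ : ℤ
      to   : ∀ v → + suc B * F v + + i ≤ F (+ suc B * v) →
        T ≤ F (v + K) - F v × (¬ T′ ≤ F (v + K′) - F v → ¬ Jump (+ suc B * v))
      from : ∀ v → T ≤ F (v + K) - F v → (T′ ≤ F (v + K′) - F v ⊎ ¬ Jump (+ suc B * v)) →
        + suc B * F v + + i ≤ F (+ suc B * v)

  private
    NearK : (B j e f : ℤ) → Set
    NearK B j e f = Σ ℤ λ K → Σ ℤ λ q → NN (- (j + B * q)) (B * K) × PP (e + (j + B * q)) (f - B * K)

    near : ∀ B j {e f} → PP e f → NearK (+ suc B) j e f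
    near B j {e} {f} ε>0 =
      let y , q , _ , below , above = density B 0 0ℤ 0ℤ j 0 ε>0
      in y , q , nn-by below (cong (λ w → - (j + w)) (ring₁ (+ suc B) q)) (ring₂ (+ suc B) y) ,
         pp-by above (cong (λ w → e + (j + w)) (ring₁ (+ suc B) q)) (cong (λ w → f - w) (ring₂ (+ suc B) y))
      where ring₁ : ∀ B q → B * 1ℤ * q ≡ B * q
            ring₁ = solve-∀
            ring₂ : ∀ B y → B * (0ℤ + 1ℤ * y) + 0ℤ ≡ B * y
            ring₂ = solve-∀

    module _ (B i : ℕ) (K q : ℤ)
      (K-lower : NN (- (+ suc B - + i + + suc B * q)) (+ suc B * K))
      (K-upper : PP (0ℤ + (+ suc B - + i + + suc B * q)) (1ℤ - + suc B * K))
      (K₁ q₁ : ℤ)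
      (K₁-lower : NN (- (+ i + + suc B * q₁)) (+ suc B * K₁))
      (K₁-upper : PP (1ℤ + (+ i + + suc B * q₁)) (- 1ℤ - + suc B * K₁))
      (v : ℤ) where

      b = + suc B

      shift⇒nn : ∀ {T K} → T ≤ F (v + K) - F v → NN (- (F v + T)) (v + K)
      shift⇒nn {T} {K} p = ≤F⇒nn (≤-by p (ring₁ (F (v + K)) (F v) T))
        where ring₁ : ∀ g f T → g - f - T ≡ g - (f + T)
              ring₁ = solve-∀

      nn⇒shift : ∀ {T K} → NN (- (F v + T)) (v + K) → T ≤ F (v + K) - F v
      nn⇒shift {T} {K} p = ≤-by (nn⇒≤F p) (ring₁ (F (v + K)) (F v) T)
        where ring₁ : ∀ g f T → g - (f + T) ≡ g - f - T
              ring₁ = solve-∀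

      threshold-to₁ : b * F v + + i ≤ F (b * v) → 1ℤ + q ≤ F (v + K) - F v
      threshold-to₁ p = nn⇒shift (nn-cancel B (nn-by (nn-add (≤F⇒nn p) K-lower)
          (ring₁ b (F v) (+ i) q) (ring₂ b v K)))
        where ring₁ : ∀ b f i q → - (b * f + i) + - (b - i + b * q) ≡ b * - (f + (1ℤ + q))
              ring₁ = solve-∀
              ring₂ : ∀ b v K → b * v + b * K ≡ b * (v + K)
              ring₂ = solve-∀

      threshold-to₂ : b * F v + + i ≤ F (b * v) → ¬ - q₁ ≤ F (v + - K₁) - F v → ¬ Jump (b * v)
      threshold-to₂ p far j = ≤-absurd₂ p F<  (trans (cong (λ z → F (b * v) - (b * F v + + i) + (1ℤ + (b * F v + + i) - (1ℤ + z))) j)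
                                (ring₃ (F (b * v)) (b * F v + + i)))
        where
        ring₁ : ∀ b f i q → b * - - (f + - q) + (1ℤ + (i + b * q)) ≡ 1ℤ + (b * f + i)
        ring₁ = solve-∀
        ring₂ : ∀ b v K → b * - (v + - K) + (- 1ℤ - b * K) ≡ - (1ℤ + b * v)
        ring₂ = solve-∀
        ring₃ : ∀ g w → g - w + (1ℤ + w - (1ℤ + (1ℤ + g))) ≡ - 1ℤ
        ring₃ = solve-∀
        F< : 1ℤ + F (1ℤ + b * v) ≤ 1ℤ + (b * F v + + i)
        F< = pp⇒F< {t = 1ℤ + b * v} (pp-by (pp-add (nn-scale (suc B) (¬NN⇒NN- λ n → far (nn⇒shift n))) K₁-upper)
               (ring₁ b (F v) (+ i) q₁) (ring₂ b v K₁))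

      threshold-from₁ : - q₁ ≤ F (v + - K₁) - F v → b * F v + + i ≤ F (b * v)
      threshold-from₁ p = nn⇒≤F (nn-by (nn-add (nn-scale (suc B) (shift⇒nn p)) K₁-lower)
          (ring₁ b (F v) (+ i) q₁) (ring₂ b v K₁))
        where ring₁ : ∀ b f i q → b * - (f + - q) + - (i + b * q) ≡ - (b * f + i)
              ring₁ = solve-∀
              ring₂ : ∀ b v K → b * (v + - K) + b * K ≡ b * v
              ring₂ = solve-∀

      threshold-from₂ : 1ℤ + q ≤ F (v + K) - F v → ¬ Jump (b * v) → b * F v + + i ≤ F (b * v)
      threshold-from₂ p ¬j = subst (b * F v + + i ≤_) (no-jump ¬j)
          (nn⇒≤F (nn-by (nn-add (nn-scale (suc B) (shift⇒nn p)) (pp⇒nn K-upper))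
            (ring₁ b (F v) (+ i) q) (ring₂ b v K)))
        where ring₁ : ∀ b f i q → b * - (f + (1ℤ + q)) + (0ℤ + (b - i + b * q)) ≡ - (b * f + i)
              ring₁ = solve-∀
              ring₂ : ∀ b v K → b * (v + K) + (1ℤ - b * K) ≡ 1ℤ + b * v
              ring₂ = solve-∀

  abstract
    threshold : ∀ B i → Threshold B i
    threshold B i =
      let K , q , lower , upper = near B (+ suc B - + i) pp-α
          K₁ , q₁ , lower₁ , upper₁ = near B (+ i) pp-1-α
      in record
        { K = K ; T = 1ℤ + q ; K′ = - K₁ ; T′ = - q₁
        ; to = λ v p → threshold-to₁ B i K q lower upper K₁ q₁ lower₁ upper₁ v p
                     , threshold-to₂ B i K q lower upper K₁ q₁ lower₁ upper₁ v p
        ; from = λ { v p (inj₁ p′) → threshold-from₁ B i K q lower upper K₁ q₁ lower₁ upper₁ v p′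
                   ; v p (inj₂ ¬j) → threshold-from₂ B i K q lower upper K₁ q₁ lower₁ upper₁ v p ¬j } }

module Definability (r : IrrationalReal) (r>1 : r >1) where
  open Cut r r>1
  open Group r r>1
  open Density r r>1
  open Elimination r r>1
  open Translation r r>1
  open Thresholds r r>1

  record Definable {n} (H : Env n → Set) (v : Env n → Bool) : Set where
    field
      formula : Formula n
      qf      : QuantifierFree formula
      sound   : ∀ ρ → H ρ → Sat r formula ρ → v ρ ≡ true
      complete : ∀ ρ → H ρ → v ρ ≡ true → Sat r formula ρ
  open Definable

  module _ {n : ℕ} where
    private
      Pred = Env n → Set
      Prop = Env n → Bool

    def-cong : ∀ {H : Pred} {v w : Prop} → (∀ ρ → H ρ → v ρ ≡ w ρ) → Definable H v → Definable H w
    def-cong e d = record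
      { formula = formula d ; qf = qf d
      ; sound = λ ρ h s → trans (sym (e ρ h)) (sound d ρ h s)
      ; complete = λ ρ h t → complete d ρ h (trans (e ρ h) t) }

    def-weaken : ∀ {H H′ : Pred} {v : Prop} → (∀ ρ → H′ ρ → H ρ) → Definable H v → Definable H′ v
    def-weaken f d = record
      { formula = formula d ; qf = qf d
      ; sound = λ ρ h → sound d ρ (f ρ h)
      ; complete = λ ρ h → complete d ρ (f ρ h) }

    def-const : ∀ {H : Pred} b → Definable H (λ _ → b)
    def-const true = record { formula = tt ; qf = tt ; sound = λ _ _ _ → refl ; complete = λ _ _ _ → _ }
    def-const false = record { formula = ff ; qf = ff ; sound = λ _ _ () ; complete = λ _ _ () }

    def-not : ∀ {H : Pred} {v : Prop} → Definable H v → Definable H (λ ρ → not (v ρ))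
    def-not d = record
      { formula = ~ formula d ; qf = neg (qf d)
      ; sound = λ ρ h ¬s → ¬true⇒not λ e → ¬s (complete d ρ h e)
      ; complete = λ ρ h e s → not⇒¬true e (sound d ρ h s) }

    def-∧ : ∀ {H : Pred} {v w : Prop} → Definable H v → Definable H w → Definable H (λ ρ → v ρ ∧ᵇ w ρ)
    def-∧ d e = record
      { formula = formula d ∧ formula e ; qf = and (qf d) (qf e)
      ; sound = λ ρ h (s , t) → ∧-true (sound d ρ h s) (sound e ρ h t)
      ; complete = λ ρ h t → let a , b = ∧-true⁻ t in complete d ρ h a , complete e ρ h b }

    def-∨ : ∀ {H : Pred} {v w : Prop} → Definable H v → Definable H w → Definable H (λ ρ → v ρ ∨ᵇ w ρ)
    def-∨ {v = v} d e = record
      { formula = formula d ∨ formula e ; qf = or (qf d) (qf e)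
      ; sound = λ ρ h s → true-stable λ ¬t →
          s ((λ a → ¬t (∨-true₁ (sound d ρ h a))) , (λ b → ¬t (∨-true₂ {v ρ} (sound e ρ h b))))
      ; complete = λ ρ h t (¬a , ¬b) → case ρ h ¬a ¬b (∨-true⁻ t) }
      where
      case : ∀ ρ → _ → ¬ Sat r (formula d) ρ → ¬ Sat r (formula e) ρ → v ρ ≡ true ⊎ _ ≡ true → ⊥
      case ρ h ¬a ¬b (inj₁ a) = ¬a (complete d ρ h a)
      case ρ h ¬a ¬b (inj₂ b) = ¬b (complete e ρ h b)

    def-cases : ∀ {H : Pred} {c v : Prop} → Definable H c →
      Definable (λ ρ → H ρ × c ρ ≡ true) v → Definable (λ ρ → H ρ × c ρ ≡ false) v → Definable H v
    def-cases {H} {c} {v} d a b = record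
      { formula = (formula d ∧ formula a) ∨ ((~ formula d) ∧ formula b)
      ; qf = or (and (qf d) (qf a)) (and (neg (qf d)) (qf b))
      ; sound = λ ρ h s → true-stable λ ¬t → s
          ( (λ (x , y) → ¬t (sound a ρ (h , sound d ρ h x) y))
          , (λ (¬x , y) → ¬t (sound b ρ (h , ¬true⇒false (λ e → ¬x (complete d ρ h e))) y)))
      ; complete = λ ρ h t (¬x , ¬y) → by ρ h t ¬x ¬y (c ρ) refl }
      where
      ¬true⇒false : ∀ {x} → ¬ x ≡ true → x ≡ false
      ¬true⇒false {true} h = contradiction refl h
      ¬true⇒false {false} _ = refl
      by : ∀ ρ → H ρ → v ρ ≡ true → ¬ (Sat r (formula d) ρ × Sat r (formula a) ρ) →
        ¬ (¬ Sat r (formula d) ρ × Sat r (formula b) ρ) → ∀ x → c ρ ≡ x → ⊥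
      by ρ h t ¬x ¬y true e = ¬x (complete d ρ h e , complete a ρ (h , e) t)
      by ρ h t ¬x ¬y false e = ¬y ((λ s → absurd (trans (sym e) (sound d ρ h s))) , complete b ρ (h , e) t)
        where absurd : false ≡ true → ⊥
              absurd ()

    def-isZero : ∀ {H : Pred} t → Definable H (λ ρ → holds ρ (isZero t))
    def-isZero t = record
      { formula = t ≐ zer ; qf = eq t zer
      ; sound = λ ρ _ e → dec-true (_ ≟ _) e ; complete = λ ρ _ e → does⇒ (_ ≟ _) e }

    def-multiple : ∀ {H : Pred} k t → Definable H (λ ρ → multiples k ∋ ⟦ t ⟧t ρ)
    def-multiple k t = record
      { formula = D+ k t ∨ D- k t ; qf = or (dp k t) (dm k t)
      ; sound = λ ρ _ s → true-stable λ ¬m → s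
          ( (λ (y , t≡ , _) → ¬m (trans (cong (multiples k ∋_) t≡) (multiples-∋ k y)))
          , (λ (y , t≡ , _) → ¬m (trans (cong (multiples k ∋_) t≡) (multiples-∋ k y))))
      ; complete = λ ρ _ m (¬p , ¬q) → ¬q (_ , multiples-∋⁻ k m , λ p → ¬p (_ , multiples-∋⁻ k m , p)) }

    def-jump : ∀ {H : Pred} k w (y : Env n → ℤ) → (∀ ρ → H ρ → ⟦ w ⟧t ρ ≡ + suc k * y ρ) →
      Definable H (λ ρ → does (jump? (y ρ)))
    def-jump k w y e = record
      { formula = D+ k w ∨ (w ≐ num (- (+ suc k))) ; qf = or (dp k w) (eq w _)
      ; sound = λ ρ h s → true-stable λ ¬j → s
          ( (λ (y′ , w≡ , p) → ¬j (dec-true (jump? _) (subst Jump (same ρ h w≡) (P⇒jump p))))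
          , (λ w≡ → ¬j (dec-true (jump? _) (subst Jump (same ρ h (trans w≡ (trans (⟦num⟧ (- (+ suc k)) ρ) (ring₁ (+ suc k))))) jump--1))))
      ; complete = λ ρ h j (¬p , ¬w) → ¬p (y ρ , e ρ h , jump⇒P (does⇒ (jump? _) j) λ y≡ →
          ¬w (trans (e ρ h) (trans (cong (+ suc k *_) y≡) (trans (sym (ring₁ (+ suc k))) (sym (⟦num⟧ (- (+ suc k)) ρ)))))) }
      where
      ring₁ : ∀ k → - k ≡ k * - 1ℤ
      ring₁ = solve-∀
      same : ∀ ρ → _ → ∀ {y′} → ⟦ w ⟧t ρ ≡ + suc k * y′ → y′ ≡ y ρ
      same ρ h {y′} w≡ = ℤP.*-cancelˡ-≡ (+ suc k) y′ (y ρ) (trans (sym w≡) (e ρ h))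

    DefinableValue : Pred → (Env n → ℤ) → Set
    DefinableValue H h = ∀ (S : ℤ → Bool) → Definable H (λ ρ → S (h ρ))

    def-at-least : ∀ {H : Pred} {h} T → DefinableValue H h → Definable H (λ ρ → does (T ≤? h ρ))
    def-at-least T d = d (λ z → does (T ≤? z))

    def-increment : ∀ {H : Pred} {h} (y : Env n → ℤ) →
      (∀ s → Definable H (λ ρ → does (jump? (y ρ + s)))) → DefinableValue H h →
      ∀ K → DefinableValue H (λ ρ → h ρ + (F (y ρ + K) - F (y ρ)))
    def-increment {H} {h} y jumps base = go
      where
      step : ∀ s s′ (δ : ℤ → ℤ) → DefinableValue H (λ ρ → h ρ + (F (y ρ + s) - F (y ρ))) → ∀ t →
        (∀ ρ → Jump (y ρ + t) → h ρ + (F (y ρ + s′) - F (y ρ)) ≡ δ (h ρ + (F (y ρ + s) - F (y ρ)))) →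
        (∀ ρ → ¬ Jump (y ρ + t) → F (y ρ + s′) ≡ F (y ρ + s)) →
        DefinableValue H (λ ρ → h ρ + (F (y ρ + s′) - F (y ρ)))
      step s s′ δ d t jumping resting S = def-cases (jumps t)
        (def-cong (λ ρ (_ , j) → cong S (sym (jumping ρ (does⇒ (jump? _) j)))) (def-weaken (λ _ → proj₁) (d (S ∘ δ))))
        (def-cong (λ ρ (_ , ¬j) → cong (λ z → S (h ρ + (z - F (y ρ)))) (sym (resting ρ (¬does ρ ¬j))))
          (def-weaken (λ _ → proj₁) (d S)))
        where
        ¬does : ∀ ρ → does (jump? (y ρ + t)) ≡ false → ¬ Jump (y ρ + t)
        ¬does ρ e j with trans (sym e) (dec-true (jump? (y ρ + t)) j)
        ... | ()
      forward : ∀ K → DefinableValue H (λ ρ → h ρ + (F (y ρ + + K) - F (y ρ)))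
      forward zero S = def-cong (λ ρ _ → cong S (trans (ring₁ (h ρ) (F (y ρ)))
          (cong (λ z → h ρ + (F z - F (y ρ))) (sym (ℤP.+-identityʳ (y ρ)))))) (base S)
        where ring₁ : ∀ h f → h ≡ h + (f - f)
              ring₁ = solve-∀
      forward (suc K) = step (+ K) (+ suc K) (λ z → 1ℤ + z) (forward K) (+ K)
          (λ ρ j → trans (cong (λ z → h ρ + (z - F (y ρ))) (trans (cong F (ring₁ (y ρ) (+ K))) j)) (ring₂ (h ρ) (F (y ρ)) (F (y ρ + + K))))
          (λ ρ ¬j → trans (cong F (ring₁ (y ρ) (+ K))) (no-jump ¬j))
        where ring₁ : ∀ y K → y + (1ℤ + K) ≡ 1ℤ + (y + K)
              ring₁ = solve-∀
              ring₂ : ∀ h f g → h + (1ℤ + g - f) ≡ 1ℤ + (h + (g - f))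
              ring₂ = solve-∀
      backward : ∀ K → DefinableValue H (λ ρ → h ρ + (F (y ρ + - (+ K)) - F (y ρ)))
      backward zero = forward zero
      backward (suc K) = step (- (+ K)) (- (+ suc K)) (_- 1ℤ) (backward K) (- (+ suc K))
          (λ ρ j → trans (ring₂ (h ρ) (F (y ρ)) (F (y ρ + - (+ suc K)))) (cong (λ z → h ρ + (z - F (y ρ)) - 1ℤ)
             (trans (sym j) (cong F (ring₁ (y ρ) (+ K))))))
          (λ ρ ¬j → trans (sym (no-jump ¬j)) (cong F (ring₁ (y ρ) (+ K))))
        where ring₁ : ∀ y K → 1ℤ + (y + - (1ℤ + K)) ≡ y + - K
              ring₁ = solve-∀
              ring₂ : ∀ h f g → h + (g - f) ≡ h + (1ℤ + g - f) - 1ℤ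
              ring₂ = solve-∀
      go : ∀ K → DefinableValue H (λ ρ → h ρ + (F (y ρ + K) - F (y ρ)))
      go (+ K) = forward K
      go -[1+ K ] = backward (suc K)

    def-bounded : ∀ {H : Pred} {h} B → (∀ i → i ℕ.< B → Definable H (λ ρ → does (+ suc i ≤? h ρ))) →
      (∀ ρ → H ρ → 0ℤ ≤ h ρ × h ρ ≤ + B) → DefinableValue H h
    def-bounded zero _ bounds S = def-cong (λ ρ h → let l , u = bounds ρ h in cong S (≤-antisym l u)) (def-const (S 0ℤ))
    def-bounded {H} {h} (suc B) least bounds S = def-cases (least B (ℕP.≤-refl))
      (def-cong (λ ρ (a , e) → cong S (≤-antisym (does⇒ (_ ≤? _) e) (proj₂ (bounds ρ a)))) (def-const (S (+ suc B))))
      (def-bounded B (λ i i<B → def-weaken (λ _ → proj₁) (least i (ℕP.m<n⇒m<1+n i<B)))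
        (λ ρ (a , e) → proj₁ (bounds ρ a) , ≤-by (≰⇒1+≤ (¬does ρ e)) (ring₁ (+ B) (h ρ))) S)
      where
      ring₁ : ∀ B h → 1ℤ + B - (1ℤ + h) ≡ B - h
      ring₁ = solve-∀
      ¬does : ∀ ρ → does (+ suc B ≤? h ρ) ≡ false → ¬ + suc B ≤ h ρ
      ¬does ρ e p with trans (sym e) (dec-true (_ ≤? _) p)
      ... | ()

    -- F t = (B+1) F v + ⌊(B+1) {α v}⌋ + (F ((B+1) v + c) − F ((B+1) v)) for t = (B+1) v + c
    module _ (B c : ℕ) (t : Term n) where
      private
        b = + suc B
        v = λ ρ → (⟦ t ⟧t ρ - + c) ÷ B
        H : Pred
        H ρ = ⟦ t ⟧t ρ ≡ b * v ρ + + c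

      def-jump-v : ∀ s → Definable H (λ ρ → does (jump? (v ρ + s)))
      def-jump-v s = def-jump B (t ⊕ num (b * s - + c)) (λ ρ → v ρ + s)
          λ ρ h → trans (cong₂ _+_ h (⟦num⟧ (b * s - + c) ρ)) (ring₁ b (v ρ) (+ c) s)
        where ring₁ : ∀ b v c s → b * v + c + (b * s - c) ≡ b * (v + s)
              ring₁ = solve-∀

      def-jump-bv : ∀ s → Definable H (λ ρ → does (jump? (b * v ρ + s)))
      def-jump-bv s = def-jump 0 (t ⊕ num (s - + c)) (λ ρ → b * v ρ + s)
          λ ρ h → trans (cong₂ _+_ h (⟦num⟧ (s - + c) ρ)) (ring₁ b (v ρ) (+ c) s)
        where ring₁ : ∀ b v c s → b * v + c + (s - c) ≡ 1ℤ * (b * v + s)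
              ring₁ = solve-∀

      def-shift : ∀ K T → Definable H (λ ρ → does (T ≤? F (v ρ + K) - F (v ρ)))
      def-shift K T = def-cong (λ ρ _ → cong (λ z → does (T ≤? z)) (ℤP.+-identityˡ _))
        (def-at-least T (def-increment v def-jump-v (λ S → def-const (S 0ℤ)) K))

      def-digit-≥ : ∀ i → Definable H (λ ρ → does (+ i ≤? F (b * v ρ) - b * F (v ρ)))
      def-digit-≥ i = def-cong equal (def-∧ (def-shift K T) (def-∨ (def-shift K′ T′)
          (def-not (def-cong (λ ρ _ → cong (λ z → does (jump? z)) (ℤP.+-identityʳ (b * v ρ))) (def-jump-bv 0ℤ)))))
        where
        open Threshold (threshold B i)
        ring₁ : ∀ f g i → g - f - i ≡ g - (f + i)
        ring₁ = solve-∀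
        ring₂ : ∀ f g i → g - (f + i) ≡ g - f - i
        ring₂ = solve-∀
        equal : ∀ ρ → H ρ → (does (T ≤? F (v ρ + K) - F (v ρ)) ∧ᵇ (does (T′ ≤? F (v ρ + K′) - F (v ρ)) ∨ᵇ
          not (does (jump? (b * v ρ))))) ≡ does (+ i ≤? F (b * v ρ) - b * F (v ρ))
        equal ρ _ = does-⇔ (mk⇔
            (λ (p , p′) → ≤-by (from (v ρ) p p′) (ring₂ (b * F (v ρ)) (F (b * v ρ)) (+ i)))
            (λ (p : + i ≤ F (b * v ρ) - b * F (v ρ)) → let p , p′ = to (v ρ) (≤-by p (ring₁ (b * F (v ρ)) (F (b * v ρ)) (+ i))) in p , near p′ (T′ ≤? _)))
          ((T ≤? _) ×-dec ((T′ ≤? _) ⊎-dec ¬? (jump? _))) (+ i ≤? _)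
          where
          near : (¬ T′ ≤ F (v ρ + K′) - F (v ρ) → ¬ Jump (b * v ρ)) → Dec (T′ ≤ F (v ρ + K′) - F (v ρ)) →
            T′ ≤ F (v ρ + K′) - F (v ρ) ⊎ ¬ Jump (b * v ρ)
          near f (yes p) = inj₁ p
          near f (no ¬p) = inj₂ (f ¬p)

      digit-bounds : ∀ v → 0ℤ ≤ F (b * v) - b * F v × F (b * v) - b * F v ≤ + B
      digit-bounds v = ≤-by (subst (λ z → b * z ≤ F (b * v)) (F-*÷ B v) (÷-lower (F (b * v)) B)) (ring₁ (F (b * v)) (b * F v)) ,
          ≤-by (subst (λ z → 1ℤ + F (b * v) ≤ b * (1ℤ + z)) (F-*÷ B v) (÷-upper (F (b * v)) B)) (ring₂ (+ B) (F (b * v)) (F v))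
        where ring₁ : ∀ g f → g - f ≡ g - f - 0ℤ
              ring₁ = solve-∀
              ring₂ : ∀ B g f → (1ℤ + B) * (1ℤ + f) - (1ℤ + g) ≡ B - (g - (1ℤ + B) * f)
              ring₂ = solve-∀

      def-floor-residue : ∀ S → pred-period S ≡ B → Definable H (λ ρ → holds ρ (floorα S t))
      def-floor-residue S refl = def-cong
        (λ ρ h → trans (sym (periodic S _ (F (v ρ)))) (cong (S ∋_)
          (trans (ring₁ (F (b * v ρ)) (b * F (v ρ)) (F (b * v ρ + + c))) (cong F (sym h)))))
        (def-increment (λ ρ → b * v ρ) def-jump-bv
          (def-bounded B (λ i _ → def-digit-≥ (suc i)) (λ ρ _ → digit-bounds (v ρ))) (+ c) (S ∋_))
        where ring₁ : ∀ g f w → g - f + (w - g) + f ≡ w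
              ring₁ = solve-∀

    def-by-residue : ∀ B t {v : Prop} → (∀ c → Definable (λ ρ → ⟦ t ⟧t ρ ≡ + suc B * ((⟦ t ⟧t ρ - + c) ÷ B) + + c) v) →
      Definable (λ _ → ⊤) v
    def-by-residue B t {v} d = def-weaken covered (go (upTo (suc B)))
      where
      t- : ℕ → Term n
      t- c = t ⊕ num (- (+ c))
      residue : ∀ c ρ → (multiples B ∋ ⟦ t- c ⟧t ρ) ≡ true → ⟦ t ⟧t ρ ≡ + suc B * ((⟦ t ⟧t ρ - + c) ÷ B) + + c
      residue c ρ e = trans (ring₁ (⟦ t ⟧t ρ) (+ c)) (cong (_+ + c)
          (multiples-∋⁻ B (trans (cong (λ z → multiples B ∋ (⟦ t ⟧t ρ + z)) (sym (⟦num⟧ (- (+ c)) ρ))) e)))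
        where ring₁ : ∀ t c → t ≡ t - c + c
              ring₁ = solve-∀
      go : ∀ l → Definable (λ ρ → Any (λ c → (multiples B ∋ ⟦ t- c ⟧t ρ) ≡ true) l) v
      go [] = record { formula = ff ; qf = ff ; sound = λ _ () ; complete = λ _ () }
      go (c ∷ l) = def-cases (def-multiple B (t- c))
        (def-weaken (λ ρ (_ , e) → residue c ρ e) (d c))
        (def-weaken (λ ρ (a , e) → skip e a) (go l))
        where
        skip : ∀ {ρ} → (multiples B ∋ ⟦ t- c ⟧t ρ) ≡ false →
          Any (λ c → (multiples B ∋ ⟦ t- c ⟧t ρ) ≡ true) (c ∷ l) → Any (λ c → (multiples B ∋ ⟦ t- c ⟧t ρ) ≡ true) l
        skip e (here e′) with trans (sym e) e′
        ... | ()
        skip e (there a) = a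
      covered : ∀ ρ → ⊤ → Any (λ c → (multiples B ∋ ⟦ t- c ⟧t ρ) ≡ true) (upTo (suc B))
      covered ρ _ =
        let c , c< , q , t≡ = remainder (⟦ t ⟧t ρ) B
        in lose (∈-upTo⁺ c<) (trans (cong (multiples B ∋_) (trans (cong₂ _+_ t≡ (⟦num⟧ (- (+ c)) ρ)) (ring₁ (+ c) (+ suc B * q))))
             (multiples-∋ B q))
        where ring₁ : ∀ c w → c + w + - c ≡ w
              ring₁ = solve-∀

    def-atom : ∀ a → Definable (λ _ → ⊤) (λ ρ → holds ρ a)
    def-atom (isZero t) = def-isZero t
    def-atom (val S t) = def-by-residue (pred-period S) t λ c → def-cong
      (λ ρ h → let q = (⟦ t ⟧t ρ - + c) ÷ pred-period S in
        trans (sym (periodic S (+ c) q)) (cong (S ∋_) (trans (ℤP.+-comm (+ c) (+ suc (pred-period S) * q)) (sym h)))) (def-const (S ∋ (+ c)))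
    def-atom (floorα S t) = def-by-residue (pred-period S) t λ c → def-floor-residue (pred-period S) c t S refl

    definable : ∀ φ → Definable (λ _ → ⊤) (λ ρ → eval φ (holds ρ))
    definable (atom a) = def-atom a
    definable (const b) = def-const b
    definable (inv φ) = def-not (definable φ)
    definable (φ & ψ) = def-∧ (definable φ) (definable ψ)
    definable (φ ∥ ψ) = def-∨ (definable φ) (definable ψ)

theorem1p2 : (r : IrrationalReal) → r >1 → HasQE r
theorem1p2 r r>1 φ = formula d , qf d , λ ρ →
    (λ s → complete d ρ _ (translate-complete φ ρ s)) , (λ s → translate-sound φ ρ (sound d ρ _ s))
  where
  open Translation r r>1
  open Definability r r>1
  open Definability.Definable
  d = definable (translate φ)
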